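{- Let $k\geq 3$ be an integer. Then a random labeled tree and a random unlabeled tree are strongly $k$-balanced, i.e.: the proportion of strongly $k$-balanced trees among all labeled trees on $n$ vertices tends to $1$ as $n\rightarrow\infty$, and the proportion of strongly $k$-balanced trees among all unlabeled trees on $n$ vertices tends to $1$ as $n\rightarrow\infty$.
   Context: A labeled tree on $n$ vertices is a tree with vertex set $\{1,\ldots,n\}$; an unlabeled tree on $n$ vertices is an isomorphism class of trees with $n$ vertices. Random trees are taken with respect to the uniform distribution, and a statement about a random tree means that it holds with probability tending to $1$ as $n\to\infty$. For $k\geq 2$, a finite simple graph $G=(V,E)$ is called strongly $k$-balanced if there exists a map (coloring) $c:V\rightarrow\{1,\ldots,k\}$ such that no edge of $G$ has both endpoints of the same color, and $|v_i(c)-v_j(c)|\leq 1$ for all distinct $i,j\in\{1,\ldots,k\}$, where $v_i(c)=|c^{ -1}(\{i\})|$. (Color classes may be empty.) -}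

module Defs where

open import Data.Bool.Base using (Bool; false; T)
open import Data.Fin.Base using (Fin)
open import Data.Fin.Permutation using (Permutation′; _⟨$⟩ʳ_; _⟨$⟩ˡ_; inverseʳ; id; flip; _∘ₚ_)
open import Data.Fin.Properties using (_≟_)
open import Data.Integer.Base using (+_)
open import Data.List.Base using (List; _∷_; _∷ʳ_; length; filter; allFin)
open import Data.List.Relation.Unary.Linked using (Linked)
open import Data.List.Relation.Unary.Unique.Propositional using (Unique)
open import Data.Nat.Base using (ℕ; NonZero; _≤_; ∣_-_∣)
open import Data.Product.Base using (Σ; Σ-syntax; ∃; ∃-syntax; _×_; _,_; proj₁)
import Data.Rational.Base as ℚ
open import Function.Bundles using (Inverse)
open import Level using (0ℓ)
open import Relation.Binary.Bundles using (Setoid)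
open import Relation.Binary.Construct.Closure.ReflexiveTransitive using (Star)
import Relation.Binary.Construct.On as On
open import Relation.Binary.PropositionalEquality
  using (_≡_; _≢_; refl; sym; trans; cong₂; setoid)
open import Relation.Nullary.Negation using (¬_)
open import Relation.Unary using (Pred)

-- Finite simple graphs on the vertex set Fin n.

record Graph (n : ℕ) : Set where
  field
    adj         : Fin n → Fin n → Bool
    symmetric   : ∀ u v → adj u v ≡ adj v u
    irreflexive : ∀ u → adj u u ≡ false

  Adj : Fin n → Fin n → Set
  Adj u v = T (adj u v)

open Graph using (adj; Adj)

-- The cycle v , v₁ , … , vₘ , v with m ≥ 2, where vs = v₁ , … , vₘ.

record Cycle {n : ℕ} (G : Graph n) : Set where
  field
    v        : Fin n
    vs       : List (Fin n)
    long     : 2 ≤ length vs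
    distinct : Unique (v ∷ vs)
    closed   : Linked (Adj G) (v ∷ (vs ∷ʳ v))

record IsTree {n : ℕ} (G : Graph n) : Set where
  field
    nonEmpty  : NonZero n
    connected : ∀ u v → Star (Adj G) u v
    acyclic   : ¬ Cycle G

record Tree (n : ℕ) : Set where
  field
    graph  : Graph n
    isTree : IsTree graph

-- Graphs are the same when they have the same edges; propositional equality
-- would also compare the proof fields and require function extensionality.

graphSetoid : ℕ → Setoid 0ℓ 0ℓ
graphSetoid n = record
  { Carrier       = Graph n
  ; _≈_           = λ G H → ∀ u v → adj G u v ≡ adj H u v
  ; isEquivalence = record
    { refl  = λ u v → refl
    ; sym   = λ G≈H u v → sym (G≈H u v)
    ; trans = λ G≈H H≈K u v → trans (G≈H u v) (H≈K u v)
    }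
  }

_≅_ : ∀ {n} → Graph n → Graph n → Set
_≅_ {n} G H = Σ[ π ∈ Permutation′ n ] (∀ u v → adj G u v ≡ adj H (π ⟨$⟩ʳ u) (π ⟨$⟩ʳ v))

isomorphismSetoid : ℕ → Setoid 0ℓ 0ℓ
isomorphismSetoid n = record
  { Carrier       = Graph n
  ; _≈_           = _≅_
  ; isEquivalence = record
    { refl  = id , λ u v → refl
    ; sym   = λ {G} {H} (π , p) → flip π , λ u v →
        trans (sym (cong₂ (adj H) (inverseʳ π) (inverseʳ π)))
              (sym (p (π ⟨$⟩ˡ u) (π ⟨$⟩ˡ v)))
    ; trans = λ (π , p) (ρ , q) → π ∘ₚ ρ , λ u v →
        trans (p u v) (q (π ⟨$⟩ʳ u) (π ⟨$⟩ʳ v))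
    }
  }

labeledTrees : ℕ → Setoid 0ℓ 0ℓ
labeledTrees n = On.setoid (graphSetoid n) (Tree.graph {n})

-- The elements of this setoid, up to its equality, are the isomorphism classes.

unlabeledTrees : ℕ → Setoid 0ℓ 0ℓ
unlabeledTrees n = On.setoid (isomorphismSetoid n) (Tree.graph {n})

classSize : ∀ {n k} → (Fin n → Fin k) → Fin k → ℕ
classSize {n} c i = length (filter (λ v → c v ≟ i) (allFin n))

record StronglyBalanced (k : ℕ) {n : ℕ} (G : Graph n) : Set where
  field
    colour   : Fin n → Fin k
    proper   : ∀ u v → Adj G u v → colour u ≢ colour v
    balanced : ∀ i j → i ≢ j → ∣ classSize colour i - classSize colour j ∣ ≤ 1

HasCardinality : Setoid 0ℓ 0ℓ → ℕ → Set
HasCardinality S m = Inverse S (setoid (Fin m))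

-- The elements of S satisfying P, with the equality of S. When S is a quotient
-- this has one element for each class with a representative satisfying P.

subsetoid : (S : Setoid 0ℓ 0ℓ) → Pred (Setoid.Carrier S) 0ℓ → Setoid 0ℓ 0ℓ
subsetoid S P = On.setoid S (proj₁ {B = P})

-- a n / b n → 1; the denominators are only required to be eventually nonzero.

RatioTendsToOne : (a b : ℕ → ℕ) → Set
RatioTendsToOne a b =
  ∀ (ε : ℚ.ℚ) → ℚ.0ℚ ℚ.< ε → ∃[ N ] ∀ n → N ≤ n →
    Σ[ b≢0 ∈ NonZero (b n) ]
      ℚ.∣ (ℚ._/_ (+ a n) (b n) {{b≢0}}) ℚ.- ℚ.1ℚ ∣ ℚ.< ε

-- The random element of S n, uniformly distributed, satisfies P with
-- probability tending to 1. Existence of the cardinalities is part of the claim;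
-- they are unique, so nothing depends on which witnesses are chosen.

AlmostAll : (S : ℕ → Setoid 0ℓ 0ℓ) → (∀ n → Pred (Setoid.Carrier (S n)) 0ℓ) → Set
AlmostAll S P =
  ∃[ good ] ∃[ total ]
    (∀ n → HasCardinality (subsetoid (S n) (P n)) (good n)) ×
    (∀ n → HasCardinality (S n) (total n)) ×
    RatioTendsToOne good total

{-# OPTIONS --safe #-}
-- Colouring.  Let A, B be the bipartition of a tree on n vertices whose degrees are at
-- most n/12, and write q = n / k.  Cut A and B into classes of the prescribed sizes
-- until one class of size q has to be shared, with x vertices in A and y in B.  If both
-- sides contain a whole class, then either the x vertices of A of lowest degree leave y
-- vertices of B without a neighbour among them, or vice versa.  Otherwise one side, say
-- B, has fewer than q vertices; then A has many leaves and B is spread over two classes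
-- filled up with vertices of A.
--
-- Counting.  So if T is not balanced, some vertex v has degree above n/12 and three of
-- its branches have at most 24 vertices each.  Rearrange their union W into a path
-- hanging from v and, for three vertices of this path, move an initial segment of one
-- block of the remaining neighbours of v below it.  This gives about n³ trees for each
-- T.  Conversely T and the lengths of the segments are recovered, up to isomorphism,
-- from the new tree, v, the end of the path and the shape of T on W, that is from
-- O(n²) labels.  Hence the proportion of trees that are not balanced is O(1/n), for
-- labelled and unlabelled trees alike.

module Submission where

open import Defs
open import Data.Bool.Base using (Bool; true; false; T; not; if_then_else_)
import Data.Bool.Properties as Bool
open import Data.Bool.Properties using (T?)
open import Data.Empty using (⊥)
open import Data.Fin.Base
  using (Fin; zero; suc; toℕ; fromℕ<; inject₁; inject≤; fromℕ; combine; remQuot; funToFin; finToFun)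
open import Data.Fin.Induction using (>-weakInduction)
open import Data.Fin.Permutation
  using (Permutation′; permutation; _⟨$⟩ʳ_; _⟨$⟩ˡ_; inverseˡ; inverseʳ; _∘ₚ_) renaming (id to idₚ; flip to flipₚ)
import Data.Fin.Properties as Fin
open import Data.Fin.Properties
  using (toℕ-fromℕ<; toℕ-injective; toℕ<n; any?; inject≤-injective; toℕ-inject₁; fromℕ<-injective; injective⇒≤; toℕ-inject≤; all?; finToFun-funToFin; combine-injective; combine-remQuot)
import Data.Integer.Base as ℤ
open import Data.Integer.Base using () renaming (+_ to pos)
import Data.Integer.Properties as ℤ
import Data.Integer.Tactic.RingSolver as ℤ
open import Data.List.Base
  using (List; []; _∷_; _++_; length; map; concat; filter; [_]; lookup; allFin; _∷ʳ_; concatMap)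
open import Data.List.Membership.DecPropositional using (_∈?_)
open import Data.List.Membership.Propositional using (_∈_; lose)
open import Data.List.Membership.Propositional.Properties
  using (∈-++⁺ˡ; ∈-++⁺ʳ; ∈-++⁻; ∈-filter⁻; ∈-allFin; ∈-filter⁺; ∈-lookup; ∈-map⁻)
open import Data.List.Properties
  using (length-++; ++-assoc; ++-identityʳ; concat-++; filter-++; filter-all; filter-none; length-tabulate; filter-notAll; length-map)
import Data.List.Relation.Binary.Permutation.Propositional as Perm
open import Data.List.Relation.Binary.Permutation.Propositional
  using (_↭_; prep; swap; ↭-refl; ↭-sym; ↭-trans; ↭-reflexive; ↭⇒↭ₛ)
open import Data.List.Relation.Binary.Permutation.Propositional.Properties
  using (↭-length; ++⁺; ++⁺ˡ; ++⁺ʳ; ++-comm; ∈-resp-↭; shift; filter-↭)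
import Data.List.Relation.Binary.Permutation.Setoid.Properties as ↭ₛ
import Data.List.Relation.Unary.All as All
open import Data.List.Relation.Unary.All using (All; []; _∷_)
import Data.List.Relation.Unary.All.Properties as All
open import Data.List.Relation.Unary.AllPairs using ([]; _∷_; AllPairs)
import Data.List.Relation.Unary.Any as Any
open import Data.List.Relation.Unary.Any using (here; there; index; Any)
import Data.List.Relation.Unary.Any.Properties as Any
open import Data.List.Relation.Unary.Any.Properties using (lookup-index)
open import Data.List.Relation.Unary.Linked using (Linked; []; [-]; _∷_)
open import Data.List.Relation.Unary.Unique.Propositional using (Unique)
import Data.List.Relation.Unary.Unique.Propositional.Properties as Unique
open import Data.List.Relation.Unary.Unique.Propositional.Properties using (allFin⁺; filter⁺)
open import Data.Nat.Base
open import Data.Nat.DivMod using (_/_; m/n*n≤m; m*n/n≡m; /-monoˡ-≤; _%_; m≡m%n+[m/n]*n; m%n<n)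
open import Data.Nat.Induction using (<-wellFounded)
open import Data.Nat.ListAction using (sum)
open import Data.Nat.ListAction.Properties using (sum-++)
open import Data.Nat.Properties
open import Data.Nat.Tactic.RingSolver using (solve-∀)
open import Data.Product.Base using (∃-syntax; _×_; _,_; proj₁; proj₂)
import Data.Rational.Base as ℚ
import Data.Rational.Properties as ℚ
import Data.Rational.Unnormalised.Base as ℚᵘ
import Data.Rational.Unnormalised.Properties as ℚᵘ
open import Data.Sum.Base using (_⊎_; inj₁; inj₂)
open import Data.Unit.Base using (⊤)
open import Function.Base using (_∘_; case_of_; it)
open import Function.Bundles using (mk⇔)
open import Function.Definitions using (Injective)
open import Induction.WellFounded using (Acc; acc)
open import Level using (0ℓ)
open import Relation.Binary.Bundles using (Setoid)
import Relation.Binary.Construct.Closure.ReflexiveTransitive as Star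
open import Relation.Binary.Construct.Closure.ReflexiveTransitive using (Star; ε; _◅_; _◅◅_)
import Relation.Binary.Definitions as Binary
open import Relation.Binary.PropositionalEquality
  using (_≡_; _≢_; refl; sym; trans; cong; cong₂; subst; module ≡-Reasoning; setoid; subst₂)
open import Relation.Binary.Structures using (IsEquivalence)
open import Relation.Nullary.Decidable using (does-⇔; dec-false)
open import Relation.Nullary.Decidable.Core
  using (Dec; yes; no; does; _×-dec_; ¬?; _⊎-dec_; decidable-stable; map′; _→-dec_)
open import Relation.Nullary.Negation.Core using (¬_; contradiction)
open import Relation.Unary using (Decidable)
open import Relation.Unary.Properties using (∁?)

-- Sums over lists

-- The bound n/12 is what the case of a small side tolerates: if Δ bounds the degrees, that case
-- needs 3 (q + 1 + Δ) + 2 q ≤ 2 n, which follows from q ≤ n/3, Δ ≤ n/12 and n ≥ 36. In the count,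
-- three free parameters have to outweigh the labels needed to undo the rearrangement. The path
-- keeps these down to two vertices: v and the end of the path determine the whole path, hence also
-- the three vertices below which children were moved, whereas naming those separately would cost a
-- factor n each. Branches of bounded size leave only boundedly many shapes on W. For unlabelled
-- trees no automorphisms are counted. One isomorphism from each new tree to the representative of
-- its class is fixed, and v and the end of the path are recorded by their images in the
-- representative. Equal records yield an isomorphism of the new trees that matches root and path,
-- and it is then an isomorphism of the original trees.

variable
  X Y : Set

∑ : ∀ {X : Set} → List X → (X → ℕ) → ℕ
∑ []       f = 0
∑ (x ∷ xs) f = f x + ∑ xs f

∑-mono : ∀ (xs : List X) {f g} → (∀ {x} → x ∈ xs → f x ≤ g x) → ∑ xs f ≤ ∑ xs g
∑-mono []       f≤g = z≤n
∑-mono (x ∷ xs) f≤g = +-mono-≤ (f≤g (here refl)) (∑-mono xs (f≤g ∘ there))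

∑-cong : ∀ (xs : List X) {f g} → (∀ {x} → x ∈ xs → f x ≡ g x) → ∑ xs f ≡ ∑ xs g
∑-cong []       f≡g = refl
∑-cong (x ∷ xs) f≡g = cong₂ _+_ (f≡g (here refl)) (∑-cong xs (f≡g ∘ there))

∑-++ : ∀ (xs ys : List X) f → ∑ (xs ++ ys) f ≡ ∑ xs f + ∑ ys f
∑-++ []       ys f = refl
∑-++ (x ∷ xs) ys f = trans (cong (f x +_) (∑-++ xs ys f)) (sym (+-assoc (f x) _ _))

∑-+ : ∀ (xs : List X) f g → ∑ xs (λ x → f x + g x) ≡ ∑ xs f + ∑ xs g
∑-+ []       f g = refl
∑-+ (x ∷ xs) f g = trans (cong (f x + g x +_) (∑-+ xs f g)) (lemma (f x) (g x) _ _)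
  where
  lemma : ∀ a b c d → a + b + (c + d) ≡ a + c + (b + d)
  lemma = solve-∀

∑-↭ : ∀ {xs ys : List X} f → xs ↭ ys → ∑ xs f ≡ ∑ ys f
∑-↭ f Perm.refl        = refl
∑-↭ f (prep x p)       = cong (f x +_) (∑-↭ f p)
∑-↭ f (swap x y p)     =
  trans (cong (λ s → f x + (f y + s)) (∑-↭ f p)) (lemma (f x) (f y) _)
  where
  lemma : ∀ a b c → a + (b + c) ≡ b + (a + c)
  lemma = solve-∀
∑-↭ f (Perm.trans p q) = trans (∑-↭ f p) (∑-↭ f q)

∑-const : ∀ (xs : List X) c → ∑ xs (λ _ → c) ≡ length xs * c
∑-const []       c = refl
∑-const (x ∷ xs) c = cong (c +_) (∑-const xs c)

∑-1 : ∀ (xs : List X) → ∑ xs (λ _ → 1) ≡ length xs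
∑-1 xs = trans (∑-const xs 1) (*-identityʳ _)

∑≡0⇒≡0 : ∀ {xs : List X} {f} → ∑ xs f ≡ 0 → ∀ {x} → x ∈ xs → f x ≡ 0
∑≡0⇒≡0 {xs = x ∷ xs} {f} eq (here refl) = m+n≡0⇒m≡0 (f x) eq
∑≡0⇒≡0 {xs = x ∷ xs} {f} eq (there x∈)  = ∑≡0⇒≡0 {f = f} (m+n≡0⇒n≡0 (f x) eq) x∈

∑-swap : ∀ (xs : List X) (ys : List Y) (e : X → Y → ℕ) →
         ∑ xs (λ x → ∑ ys (e x)) ≡ ∑ ys (λ y → ∑ xs (λ x → e x y))
∑-swap []       ys e = sym (trans (∑-const ys 0) (*-zeroʳ (length ys)))
∑-swap (x ∷ xs) ys e =
  trans (cong (∑ ys (e x) +_) (∑-swap xs ys e)) (sym (∑-+ ys (e x) _))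

↭-filter : ∀ {P : X → Set} (P? : Decidable P) (xs : List X) →
           xs ↭ filter P? xs ++ filter (∁? P?) xs
↭-filter P? []       = ↭-refl
↭-filter P? (x ∷ xs) with P? x
... | yes _ = prep x (↭-filter P? xs)
... | no  _ = ↭-trans (prep x (↭-filter P? xs)) (↭-sym (shift x (filter P? xs) _))

∑-empty : ∀ (xs : List X) {f} → length xs ≡ 0 → ∑ xs f ≡ 0
∑-empty [] _ = refl

maximum : ∀ (f : X → ℕ) x xs →
  ∃[ m ] ∃[ ys ] (x ∷ xs ↭ m ∷ ys) × (∀ {y} → y ∈ m ∷ ys → f y ≤ f m)
maximum f x []       = x , [] , ↭-refl , λ { (here refl) → ≤-refl }
maximum f x (z ∷ zs) with maximum f z zs
... | m , ys , p , max with f x ≤? f m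
... | yes x≤m = m , x ∷ ys , ↭-trans (prep x p) (swap x m ↭-refl) ,
                λ { (here refl)         → ≤-refl
                  ; (there (here refl)) → x≤m
                  ; (there (there y∈))  → max (there y∈) }
... | no  x≰m = x , m ∷ ys , prep x p ,
                λ { (here refl) → ≤-refl
                  ; (there y∈)  → ≤-trans (max y∈) (≰⇒≥ x≰m) }

-- By repeatedly discarding an element of maximal weight.

lightest : ∀ (f : X → ℕ) l r xs → length xs ≡ l → r ≤ l →
  ∃[ ys ] ∃[ zs ] (xs ↭ ys ++ zs) × length ys ≡ r × ∑ ys f * l ≤ r * ∑ xs f
lightest f l r xs len r≤l with m≤n⇒m<n∨m≡n r≤l
... | inj₂ refl = xs , [] , ↭-sym (↭-reflexive (++-identityʳ xs)) , len , ≤-reflexive (*-comm (∑ xs f) l)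
lightest f (suc l) r (x ∷ xs) len r≤l | inj₁ (s≤s r≤l′) with maximum f x xs
... | m , ms , p , max with lightest f l r ms (suc-injective (trans (sym (↭-length p)) len)) r≤l′
... | ys , zs , q , lenys , le = ys , m ∷ zs ,
      ↭-trans p (↭-trans (prep m q) (↭-sym (shift m ys zs))) , lenys , bound l r≤l′ le sum≤ ∑ms
  where
  lenms : length ms ≡ l
  lenms = suc-injective (trans (sym (↭-length p)) len)
  ∑ms : ∑ (x ∷ xs) f ≡ f m + ∑ ms f
  ∑ms = ∑-↭ f p
  sum≤ : ∑ ms f ≤ l * f m
  sum≤ = ≤-trans (∑-mono ms (max ∘ there))
           (≤-reflexive (trans (∑-const ms (f m)) (cong (_* f m) lenms)))
  bound : ∀ l → r ≤ l → ∑ ys f * l ≤ r * ∑ ms f → ∑ ms f ≤ l * f m → ∑ (x ∷ xs) f ≡ f m + ∑ ms f →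
          ∑ ys f * suc l ≤ r * ∑ (x ∷ xs) f
  bound zero    z≤n _ _ _ = ≤-trans (≤-reflexive (cong (_* 1) (∑-empty ys lenys))) z≤n
  bound (suc l) _ h₁ h₂ eq = *-cancelʳ-≤ _ _ (suc l) (begin
    ∑ ys f * suc (suc l) * suc l   ≡⟨ eq₁ (∑ ys f) (suc (suc l)) (suc l) ⟩
    ∑ ys f * suc l * suc (suc l)   ≤⟨ *-monoˡ-≤ (suc (suc l)) h₁ ⟩
    r * ∑ ms f * suc (suc l)       ≡⟨ eq₂ r (∑ ms f) (suc l) ⟩
    r * (∑ ms f + ∑ ms f * suc l)  ≤⟨ *-monoʳ-≤ r (+-monoˡ-≤ (∑ ms f * suc l) h₂) ⟩
    r * (suc l * f m + ∑ ms f * suc l) ≡⟨ eq₃ r (suc l) (f m) (∑ ms f) ⟩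
    r * (f m + ∑ ms f) * suc l     ≡⟨ cong (λ s → r * s * suc l) eq ⟨
    r * ∑ (x ∷ xs) f * suc l ∎)
    where
    open ≤-Reasoning
    eq₁ : ∀ a b c → a * b * c ≡ a * c * b
    eq₁ = solve-∀
    eq₂ : ∀ a b c → a * b * suc c ≡ a * (b + b * c)
    eq₂ = solve-∀
    eq₃ : ∀ a b c d → a * (b * c + d * b) ≡ a * (c + d) * b
    eq₃ = solve-∀

-- Colour classes of bipartite graphs

split-at : ∀ r (xs : List X) → r ≤ length xs → ∃[ ys ] ∃[ zs ] xs ≡ ys ++ zs × length ys ≡ r
split-at zero    xs       _         = [] , xs , refl , refl
split-at (suc r) (x ∷ xs) (s≤s r≤)  with split-at r xs r≤
... | ys , zs , refl , refl = x ∷ ys , zs , refl , refl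

++-interchange : ∀ (ws xs ys zs : List X) → (ws ++ xs) ++ (ys ++ zs) ↭ (ws ++ ys) ++ (xs ++ zs)
++-interchange ws xs ys zs =
  ↭-trans (↭-reflexive (++-assoc ws xs (ys ++ zs)))
  (↭-trans (++⁺ˡ ws (↭-trans (↭-reflexive (sym (++-assoc xs ys zs)))
                    (↭-trans (++⁺ʳ zs (++-comm xs ys)) (↭-reflexive (++-assoc ys xs zs)))))
  (↭-reflexive (sym (++-assoc ws ys (xs ++ zs)))))

length-filter≤∑ : ∀ {P : X → Set} (P? : Decidable P) {f} → (∀ {x} → P x → 1 ≤ f x) →
                  ∀ xs → length (filter P? xs) ≤ ∑ xs f
length-filter≤∑ P? {f} 1≤f []       = z≤n
length-filter≤∑ P? {f} 1≤f (x ∷ xs) with P? x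
... | yes p = +-mono-≤ (1≤f p) (length-filter≤∑ P? 1≤f xs)
... | no  _ = ≤-trans (length-filter≤∑ P? 1≤f xs) (m≤n+m _ (f x))

AlmostEqual : ℕ → ℕ → Set
AlmostEqual q s = s ≡ q ⊎ s ≡ suc q

module _ {V : Set} (e : V → V → ℕ) (q : ℕ) where

  Independent : List V → Set
  Independent xs = ∀ {x y} → x ∈ xs → y ∈ xs → e x y ≡ 0

  ColourClass : List V → Set
  ColourClass xs = Independent xs × AlmostEqual q (length xs)

  Classes : ℕ → List V → Set
  Classes k xs = ∃[ segs ] (concat segs ↭ xs) × All ColourClass segs × length segs ≡ k

  classes-↭ : ∀ {k xs ys} → xs ↭ ys → Classes k xs → Classes k ys
  classes-↭ p (segs , q , all , len) = segs , ↭-trans q p , all , len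

  classes-++ : ∀ {k l xs ys} → Classes k xs → Classes l ys → Classes (k + l) (xs ++ ys)
  classes-++ (segs , p , all , refl) (segs′ , p′ , all′ , refl) =
    segs ++ segs′ , ↭-trans (↭-reflexive (sym (concat-++ segs segs′))) (++⁺ p p′) ,
    All.++⁺ all all′ , length-++ segs

  singleClass : ∀ {xs} → Independent xs → AlmostEqual q (length xs) → Classes 1 xs
  singleClass {xs} i s = xs ∷ [] , ↭-reflexive (++-identityʳ xs) , (i , s) ∷ [] , refl

  chunk : ∀ {sizes} → All (AlmostEqual q) sizes → ∀ xs → Independent xs →
          length xs ≡ sum sizes → Classes (length sizes) xs
  chunk []       []      _  _   = [] , ↭-refl , [] , refl
  chunk {s ∷ ss} (p ∷ ps) xs ind len with split-at s xs (≤-trans (m≤m+n s (sum ss)) (≤-reflexive (sym len)))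
  ... | ys , zs , refl , refl =
    classes-++ (singleClass (λ x∈ y∈ → ind (∈-++⁺ˡ x∈) (∈-++⁺ˡ y∈)) p)
               (chunk ps zs (λ x∈ y∈ → ind (∈-++⁺ʳ ys x∈) (∈-++⁺ʳ ys y∈))
                  (+-cancelˡ-≡ (length ys) _ _ (trans (sym (length-++ ys)) len)))

  -- `suc m` is the number of vertices, so `edges` is the bound n - 1 for a tree. Together with
  -- positive and bounded degrees this is all that the colouring takes from the tree.
  record Bipartite (m : ℕ) (As Bs : List V) : Set where
    field
      symmetric : ∀ x y → e x y ≡ e y x
      size      : length As + length Bs ≡ suc m
      edges     : ∑ As (λ a → ∑ Bs (e a)) ≤ m
      indepˡ    : Independent As
      indepʳ    : Independent Bs
      positiveˡ : ∀ {a} → a ∈ As → 1 ≤ ∑ Bs (e a)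
      positiveʳ : ∀ {b} → b ∈ Bs → 1 ≤ ∑ As (e b)
      boundedˡ  : ∀ {a} → a ∈ As → ∑ Bs (e a) * 12 ≤ suc m
      boundedʳ  : ∀ {b} → b ∈ Bs → ∑ As (e b) * 12 ≤ suc m

  flip : ∀ {m As Bs} → Bipartite m As Bs → Bipartite m Bs As
  flip {m} {As} {Bs} G = record
    { symmetric = symmetric
    ; size      = trans (+-comm (length Bs) (length As)) size
    ; edges     = ≤-trans (≤-reflexive (trans (∑-swap Bs As e)
                    (∑-cong As (λ {a} _ → ∑-cong Bs (λ {b} _ → symmetric b a))))) edges
    ; indepˡ    = indepʳ
    ; indepʳ    = indepˡ
    ; positiveˡ = positiveʳ
    ; positiveʳ = positiveˡ
    ; boundedˡ  = boundedʳ
    ; boundedʳ  = boundedˡ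
    }
    where open Bipartite G

  independent-++ : (∀ x y → e x y ≡ e y x) → ∀ {xs ys} → Independent xs → Independent ys →
    (∀ {x y} → x ∈ xs → y ∈ ys → e x y ≡ 0) → Independent (xs ++ ys)
  independent-++ symm {xs} ix iy ixy p p′ with ∈-++⁻ xs p | ∈-++⁻ xs p′
  ... | inj₁ x | inj₁ y = ix x y
  ... | inj₁ x | inj₂ y = ixy x y
  ... | inj₂ x | inj₁ y = trans (symm _ _) (ixy y x)
  ... | inj₂ x | inj₂ y = iy x y

  -- The `x` vertices of lowest degree in A have total degree at most x m / |A|, hence at most
  -- `sum s₂` by hypothesis. So at most |B| - y vertices of B have a neighbour among them, and `y`
  -- vertices remain to complete the shared class.
  oneMixedClass : ∀ {m As Bs} → Bipartite m As Bs → ∀ {s₁ s₂ x y} →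
    All (AlmostEqual q) s₁ → All (AlmostEqual q) s₂ →
    length As ≡ sum s₁ + x → length Bs ≡ sum s₂ + y → x + y ≡ q →
    x * m ≤ sum s₂ * length As →
    Classes (suc (length s₁ + length s₂)) (As ++ Bs)
  oneMixedClass {m} {As} {Bs} G {s₁} {s₂} {x} {y} eq₁ eq₂ lenA lenB x+y xm≤
    with lightest (λ a → ∑ Bs (e a)) (length As) x As refl
           (≤-trans (m≤n+m x (sum s₁)) (≤-reflexive (sym lenA)))
  ... | X , A′ , pA , lenX , light
    with split-at y (filter (λ b → ∑ X (λ a → e a b) ≟ 0) Bs) y≤
    where
    open Bipartite G
    open ≤-Reasoning
    F F′ : List V
    F  = filter (λ b → ∑ X (λ a → e a b) ≟ 0) Bs
    F′ = filter (∁? (λ b → ∑ X (λ a → e a b) ≟ 0)) Bs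
    -- Division by |A|; if A is empty, then so is `X`.
    cancel : ∀ l → length As ≡ l → ∑ X (λ a → ∑ Bs (e a)) ≤ sum s₂
    cancel zero    eq = ≤-trans (≤-reflexive (∑-empty X
      (trans lenX (m+n≡0⇒n≡0 (sum s₁) (trans (sym lenA) eq))))) z≤n
    cancel (suc l) eq = *-cancelʳ-≤ _ _ (suc l) (begin
      ∑ X (λ a → ∑ Bs (e a)) * suc l     ≡⟨ cong (∑ X (λ a → ∑ Bs (e a)) *_) eq ⟨
      ∑ X (λ a → ∑ Bs (e a)) * length As ≤⟨ light ⟩
      x * ∑ As (λ a → ∑ Bs (e a))        ≤⟨ *-monoʳ-≤ x edges ⟩
      x * m                              ≤⟨ xm≤ ⟩
      sum s₂ * length As                 ≡⟨ cong (sum s₂ *_) eq ⟩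
      sum s₂ * suc l                     ∎)
    F′≤ : length F′ ≤ sum s₂
    F′≤ = begin
      length F′                          ≤⟨ length-filter≤∑ _ n≢0⇒n>0 Bs ⟩
      ∑ Bs (λ b → ∑ X (λ a → e a b))     ≡⟨ ∑-swap X Bs e ⟨
      ∑ X (λ a → ∑ Bs (e a))             ≤⟨ cancel _ refl ⟩
      sum s₂                             ∎
    y≤ : y ≤ length F
    y≤ = +-cancelˡ-≤ (sum s₂) _ _ (begin
      sum s₂ + y           ≡⟨ lenB ⟨
      length Bs            ≡⟨ ↭-length (↭-filter (λ b → ∑ X (λ a → e a b) ≟ 0) Bs) ⟩
      length (F ++ F′)     ≡⟨ length-++ F ⟩
      length F + length F′ ≤⟨ +-monoʳ-≤ (length F) F′≤ ⟩
      length F + sum s₂    ≡⟨ +-comm (length F) _ ⟩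
      sum s₂ + length F    ∎)
  ... | Y , F₂ , F≡ , lenY =
    classes-↭ perm (classes-++ (singleClass indXY (inj₁ (trans (length-++ X)
        (trans (cong₂ _+_ lenX lenY) x+y))))
      (classes-++ (chunk eq₁ A′ (λ p p′ → indepˡ (A′⊆ p) (A′⊆ p′)) lenA′)
                  (chunk eq₂ (F₂ ++ F′) (λ p p′ → indepʳ (B′⊆ p) (B′⊆ p′)) lenB′)))
    where
    open Bipartite G
    F′ : List V
    F′ = filter (∁? (λ b → ∑ X (λ a → e a b) ≟ 0)) Bs
    pB : Bs ↭ Y ++ (F₂ ++ F′)
    pB = ↭-trans (↭-filter (λ b → ∑ X (λ a → e a b) ≟ 0) Bs)
           (↭-reflexive (trans (cong (_++ F′) F≡) (++-assoc Y F₂ F′)))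
    perm : (X ++ Y) ++ (A′ ++ (F₂ ++ F′)) ↭ As ++ Bs
    perm = ↭-trans (++-interchange X Y A′ (F₂ ++ F′)) (↭-sym (++⁺ pA pB))
    A′⊆ : ∀ {z} → z ∈ A′ → z ∈ As
    A′⊆ z∈ = ∈-resp-↭ (↭-sym pA) (∈-++⁺ʳ X z∈)
    X⊆ : ∀ {z} → z ∈ X → z ∈ As
    X⊆ z∈ = ∈-resp-↭ (↭-sym pA) (∈-++⁺ˡ z∈)
    B′⊆ : ∀ {z} → z ∈ F₂ ++ F′ → z ∈ Bs
    B′⊆ z∈ = ∈-resp-↭ (↭-sym pB) (∈-++⁺ʳ Y z∈)
    Y⊆ : ∀ {z} → z ∈ Y → z ∈ Bs
    Y⊆ z∈ = ∈-resp-↭ (↭-sym pB) (∈-++⁺ˡ z∈)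
    lenA′ : length A′ ≡ sum s₁
    lenA′ = +-cancelˡ-≡ x _ _ (trans (trans (cong (_+ length A′) (sym lenX))
      (trans (sym (length-++ X)) (sym (↭-length pA)))) (trans lenA (+-comm (sum s₁) x)))
    lenB′ : length (F₂ ++ F′) ≡ sum s₂
    lenB′ = +-cancelˡ-≡ y _ _ (trans (trans (cong (_+ length (F₂ ++ F′)) (sym lenY))
      (trans (sym (length-++ Y)) (sym (↭-length pB)))) (trans lenB (+-comm (sum s₂) y)))
    indXY : Independent (X ++ Y)
    indXY = independent-++ symmetric (λ p p′ → indepˡ (X⊆ p) (X⊆ p′)) (λ p p′ → indepʳ (Y⊆ p) (Y⊆ p′))
      (λ {a} {b} a∈ b∈ → ∑≡0⇒≡0 {f = λ a → e a b}
         (proj₂ (∈-filter⁻ (λ b → ∑ X (λ a → e a b) ≟ 0) {xs = Bs}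
                  (subst (b ∈_) (sym F≡) (∈-++⁺ˡ b∈)))) a∈)

∑≤length-filter : ∀ {P : X → Set} (P? : Decidable P) {f} → (∀ x → f x ≤ 1) → (∀ {x} → ¬ P x → f x ≡ 0) →
                  ∀ xs → ∑ xs f ≤ length (filter P? xs)
∑≤length-filter P? f≤1 f≡0 []       = z≤n
∑≤length-filter P? f≤1 f≡0 (x ∷ xs) with P? x
... | yes _  = +-mono-≤ (f≤1 x) (∑≤length-filter P? f≤1 f≡0 xs)
... | no  ¬p rewrite f≡0 ¬p = ∑≤length-filter P? f≤1 f≡0 xs

-- Entries are taken until the weight reaches `t`, and the last one overshoots by at most `Δ`. That
-- the prefix weighs at least `t` is stated through its effect on the remainder, since this form
-- stays true when the list runs out early and nothing remains.
prefix-of-weight : ∀ (g : X → ℕ) Δ t xs → (∀ {x} → x ∈ xs → g x ≤ Δ) →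
  ∃[ ys ] ∃[ zs ] xs ≡ ys ++ zs × ∑ ys g ≤ t + Δ × (∀ G → ∑ xs g ≤ t + G → ∑ zs g ≤ G)
prefix-of-weight g Δ t []       bd = [] , [] , refl , z≤n , λ _ _ → z≤n
prefix-of-weight g Δ t (x ∷ xs) bd with t ≤? g x
... | yes t≤ = [ x ] , xs , refl ,
  ≤-trans (≤-reflexive (+-identityʳ (g x))) (≤-trans (bd (here refl)) (m≤n+m Δ t)) ,
  λ G le → +-cancelˡ-≤ (g x) _ _ (≤-trans le (+-monoˡ-≤ G t≤))
... | no t≰ with m≤n⇒∃[o]m+o≡n (≰⇒≥ t≰)
... | o , refl with prefix-of-weight g Δ o xs (bd ∘ there)
... | ys , zs , refl , le , rest = x ∷ ys , zs , refl ,
  ≤-trans (+-monoʳ-≤ (g x) le) (≤-reflexive (sym (+-assoc (g x) o Δ))) ,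
  λ G le′ → rest G (+-cancelˡ-≤ (g x) _ _ (≤-trans le′ (≤-reflexive (+-assoc (g x) o G))))

-- Three consecutive segments of bounded g-weight cover the list, so one of them
-- carries a third of the h-weight.

segment : ∀ (g h : X → ℕ) Δ t d xs → (∀ {x} → x ∈ xs → g x ≤ Δ) →
  ∑ xs g ≤ t + (t + t) → length xs + (d + (d + d)) ≤ ∑ xs h →
  ∃[ ys ] ∃[ zs ] (xs ↭ ys ++ zs) × ∑ zs g ≤ t + Δ × length zs + d ≤ ∑ zs h
segment g h Δ t d xs bd ∑g ∑h with prefix-of-weight g Δ t xs bd
... | p₁ , rest , refl , le₁ , rest≤ with prefix-of-weight g Δ t rest (bd ∘ ∈-++⁺ʳ p₁)
... | p₂ , p₃ , refl , le₂ , rest≤′ with length p₁ + d ≤? ∑ p₁ h | length p₂ + d ≤? ∑ p₂ h | length p₃ + d ≤? ∑ p₃ h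
... | yes h₁ | _ | _ = p₂ ++ p₃ , p₁ , ++-comm p₁ (p₂ ++ p₃) , le₁ , h₁
... | no _ | yes h₂ | _ = p₁ ++ p₃ , p₂ ,
  ↭-trans (++⁺ˡ p₁ (++-comm p₂ p₃)) (↭-reflexive (sym (++-assoc p₁ p₃ p₂))) , le₂ , h₂
-- After two prefixes with threshold `t`, at most `t` of the total 3 t is left.
... | no _ | no _ | yes h₃ = p₁ ++ p₂ , p₃ , ↭-reflexive (sym (++-assoc p₁ p₂ p₃)) ,
  ≤-trans (rest≤′ t (rest≤ (t + t) ∑g)) (m≤m+n t Δ) , h₃
... | no h₁ | no h₂ | no h₃ = contradiction ∑h (<⇒≱ (begin-strict
  ∑ (p₁ ++ p₂ ++ p₃) h                ≡⟨ ∑-++ p₁ (p₂ ++ p₃) h ⟩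
  ∑ p₁ h + ∑ (p₂ ++ p₃) h             ≡⟨ cong (∑ p₁ h +_) (∑-++ p₂ p₃ h) ⟩
  ∑ p₁ h + (∑ p₂ h + ∑ p₃ h)          <⟨ +-mono-< (≰⇒> h₁) (+-mono-< (≰⇒> h₂) (≰⇒> h₃)) ⟩
  length p₁ + d + (length p₂ + d + (length p₃ + d))   ≡⟨ regroup (length p₁) (length p₂) (length p₃) d ⟩
  length p₁ + (length p₂ + length p₃) + (d + (d + d)) ≡⟨ cong (λ l → length p₁ + l + (d + (d + d))) (length-++ p₂) ⟨
  length p₁ + length (p₂ ++ p₃) + (d + (d + d))       ≡⟨ cong (_+ (d + (d + d))) (length-++ p₁) ⟨
  length (p₁ ++ p₂ ++ p₃) + (d + (d + d)) ∎))
  where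
  open ≤-Reasoning
  regroup : ∀ a b c d → a + d + (b + d + (c + d)) ≡ a + (b + c) + (d + (d + d))
  regroup = solve-∀

AlmostEqual⇒≤ : ∀ {q s} → AlmostEqual q s → s ≤ suc q
AlmostEqual⇒≤ (inj₁ refl) = n≤1+n _
AlmostEqual⇒≤ (inj₂ refl) = ≤-refl

-- Here α and β stand for |A| and |B|, Δ for the degree bound and n for `suc m`. With t = α - s - Δ,
-- the claim α ≤ 3 t amounts to 3 (s + Δ) ≤ 2 α. As α ≥ n - q and s ≤ q + 1, it is enough that 3 + 3
-- Δ ≤ 2 n - 5 q. The left side is at most n/12 + n/4 = n/3, and the right side is at least n/3:
-- hence the constants 36 and 12.
room : ∀ α β d {q s Δ m} → s ≤ suc q → Δ * 12 ≤ suc m → α + β ≡ suc m → β + d ≡ q →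
       q * 3 ≤ suc m → 36 ≤ suc m → ∃[ t ] α ≡ s + Δ + t × α ≤ t + (t + t)
room α β d {q} {s} {Δ} {m} s≤ Δ≤ size refl 3q≤ 36≤ with m≤n⇒∃[o]m+o≡n 3q≤
... | r , q*3+r = conclude
  where
  open ≤-Reasoning
  -- For n = 3 q + r the bound 2 n - 5 q is q + 2 r. The generous coefficient 7 makes the two
  -- estimates in `Δ-small` add up to exactly 4 (q + 2 r).
  q≥ : 12 ≤ q + r * 7
  q≥ = *-cancelʳ-≤ 12 _ 3 (begin
    12 * 3                  ≤⟨ 36≤ ⟩
    suc m                   ≡⟨ q*3+r ⟨
    q * 3 + r               ≤⟨ +-monoʳ-≤ (q * 3) (≤-trans (m≤m*n r 7) (m≤m*n (r * 7) 3)) ⟩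
    q * 3 + r * 7 * 3       ≡⟨ *-distribʳ-+ 3 q (r * 7) ⟨
    (q + r * 7) * 3         ∎)
  id₁ : ∀ Δ → (3 + Δ * 3) * 4 ≡ 12 + Δ * 12
  id₁ = solve-∀
  id₂ : ∀ q r → q + r * 7 + (q * 3 + r) ≡ (q + r * 2) * 4
  id₂ = solve-∀
  Δ-small : 3 + Δ * 3 ≤ q + r * 2
  Δ-small = *-cancelʳ-≤ _ _ 4 (begin
    (3 + Δ * 3) * 4         ≡⟨ id₁ Δ ⟩
    12 + Δ * 12             ≤⟨ +-mono-≤ q≥ Δ≤ ⟩
    q + r * 7 + suc m       ≡⟨ cong (q + r * 7 +_) q*3+r ⟨
    q + r * 7 + (q * 3 + r) ≡⟨ id₂ q r ⟩
    (q + r * 2) * 4         ∎)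
  id₃ : ∀ q Δ → (suc q + Δ) * 3 ≡ 3 + Δ * 3 + q * 3
  id₃ = solve-∀
  id₄ : ∀ q r → q + r * 2 + q * 3 + q * 2 ≡ (q * 3 + r) * 2
  id₄ = solve-∀
  bound : (s + Δ) * 3 ≤ α * 2
  bound = +-cancelʳ-≤ (β * 2) _ _ (begin
    (s + Δ) * 3 + β * 2              ≤⟨ +-mono-≤ (*-monoˡ-≤ 3 (+-monoˡ-≤ Δ s≤)) (*-monoˡ-≤ 2 (m≤m+n β d)) ⟩
    (suc q + Δ) * 3 + q * 2          ≡⟨ cong (_+ q * 2) (id₃ q Δ) ⟩
    3 + Δ * 3 + q * 3 + q * 2        ≤⟨ +-monoˡ-≤ (q * 2) (+-monoˡ-≤ (q * 3) Δ-small) ⟩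
    q + r * 2 + q * 3 + q * 2        ≡⟨ id₄ q r ⟩
    (q * 3 + r) * 2                  ≡⟨ cong (_* 2) q*3+r ⟩
    suc m * 2                        ≡⟨ cong (_* 2) size ⟨
    (α + β) * 2                      ≡⟨ *-distribʳ-+ 2 α β ⟩
    α * 2 + β * 2                    ∎)
  conclude : ∃[ t ] α ≡ s + Δ + t × α ≤ t + (t + t)
  conclude with s + Δ ≤? α
  ... | no ≰  = contradiction (*-monoʳ-≤ α (n≤1+n 2)) (<⇒≱ (<-≤-trans (*-monoˡ-< 3 (≰⇒> ≰)) bound))
  ... | yes ≤α with m≤n⇒∃[o]m+o≡n ≤α
  ... | t , refl = t , refl , ≤-trans (+-monoˡ-≤ t (+-cancelˡ-≤ ((s + Δ) * 2) _ _ (begin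
      (s + Δ) * 2 + (s + Δ)   ≡⟨ id₅ (s + Δ) ⟩
      (s + Δ) * 3             ≤⟨ bound ⟩
      (s + Δ + t) * 2         ≡⟨ id₆ (s + Δ) t ⟩
      (s + Δ) * 2 + (t + t)   ∎))) (≤-reflexive (+-comm (t + t) t))
    where
    id₅ : ∀ x → x * 2 + x ≡ x * 3
    id₅ = solve-∀
    id₆ : ∀ x t → (x + t) * 2 ≡ x * 2 + (t + t)
    id₆ = solve-∀

-- For `l` the number of leaves in A: l ≥ 2 α - m = n + 1 - 2 β ≥ 3 q - 2 β = β + 3 d, where n =
-- `suc m`.
enough : ∀ α β d {q m l} → α + β ≡ suc m → β + d ≡ q → q * 3 ≤ suc m → α + α ≤ l + m →
         β + (d + (d + d)) ≤ l
enough α β d {_} {m} {l} size refl 3q≤ h = +-cancelʳ-≤ (m + (β + β)) _ _ (begin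
  β + (d + (d + d)) + (m + (β + β))  ≡⟨ id₁ β d m ⟩
  (β + d) * 3 + m                    ≤⟨ +-mono-≤ 3q≤ (n≤1+n m) ⟩
  suc m + suc m                      ≡⟨ cong₂ _+_ size size ⟨
  α + β + (α + β)                    ≡⟨ id₂ α β ⟩
  α + α + (β + β)                    ≤⟨ +-monoˡ-≤ (β + β) h ⟩
  l + m + (β + β)                    ≡⟨ +-assoc l m (β + β) ⟩
  l + (m + (β + β))                  ∎)
  where
  open ≤-Reasoning
  id₁ : ∀ β d m → β + (d + (d + d)) + (m + (β + β)) ≡ (β + d) * 3 + m
  id₁ = solve-∀
  id₂ : ∀ α β → α + β + (α + β) ≡ α + α + (β + β)
  id₂ = solve-∀

module _ {V : Set} (e : V → V → ℕ) (q : ℕ) where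

  module _ {m : ℕ} {As Bs : List V} (G : Bipartite e q m As Bs) where
    open Bipartite G

    private
      -- Degrees are positive, so 2 ∸ degree is the indicator of a leaf, and `leaves b` counts the
      -- leaves adjacent to `b`.
      degˡ degʳ leaf leaves : V → ℕ
      degˡ a   = ∑ Bs (e a)
      degʳ b   = ∑ As (e b)
      leaf a   = 2 ∸ degˡ a
      leaves b = ∑ As (λ a → e a b * leaf a)

      ∑-leaves : ∀ Bs′ → ∑ Bs′ leaves ≡ ∑ As (λ a → ∑ Bs′ (e a) * leaf a)
      ∑-leaves Bs′ = trans (sym (∑-swap As Bs′ (λ a b → e a b * leaf a)))
                           (∑-cong As (λ {a} _ → ∑-*ʳ Bs′ (e a) (leaf a)))
        where
        ∑-*ʳ : ∀ (xs : List V) f c → ∑ xs (λ x → f x * c) ≡ ∑ xs f * c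
        ∑-*ʳ []       f c = refl
        ∑-*ʳ (x ∷ xs) f c = trans (cong (f x * c +_) (∑-*ʳ xs f c)) (sym (*-distribʳ-+ c (f x) _))

      degʳ-∑ : ∀ Bs′ → ∑ As (λ a → ∑ Bs′ (e a)) ≡ ∑ Bs′ degʳ
      degʳ-∑ Bs′ = trans (∑-swap As Bs′ e) (∑-cong Bs′ (λ {b} _ → ∑-cong As (λ {a} _ → symmetric a b)))

    -- Each vertex of A is a leaf or has degree at least two, so its degree, increased by one for a
    -- leaf, is at least two. The degrees sum to at most `m`.
    many-leaves : length As + length As ≤ ∑ Bs leaves + m
    many-leaves = begin
      length As + length As                              ≡⟨ cong₂ _+_ (∑-1 As) (∑-1 As) ⟨
      ∑ As (λ _ → 1) + ∑ As (λ _ → 1)                    ≡⟨ ∑-+ As (λ _ → 1) (λ _ → 1) ⟨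
      ∑ As (λ _ → 2)                                     ≤⟨ ∑-mono As (λ {a} a∈ → pointwise (degˡ a) (positiveˡ a∈)) ⟩
      ∑ As (λ a → degˡ a * leaf a + degˡ a)              ≡⟨ ∑-+ As (λ a → degˡ a * leaf a) degˡ ⟩
      ∑ As (λ a → degˡ a * leaf a) + ∑ As degˡ           ≡⟨ cong (_+ ∑ As degˡ) (∑-leaves Bs) ⟨
      ∑ Bs leaves + ∑ As degˡ                            ≤⟨ +-monoʳ-≤ (∑ Bs leaves) edges ⟩
      ∑ Bs leaves + m                                    ∎
      where
      open ≤-Reasoning
      pointwise : ∀ d → 1 ≤ d → 2 ≤ d * (2 ∸ d) + d
      pointwise 1             _ = ≤-refl
      pointwise (suc (suc d)) _ = ≤-trans (s≤s (s≤s z≤n)) (m≤n+m (suc (suc d)) (suc (suc d) * (2 ∸ suc (suc d))))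

    -- The small side is divided as B₁ ++ B₂; one class consists of B₁ and vertices with
    -- no neighbour in B₁, the other of B₂ and vertices with no neighbour in B₂.

    twoMixedClasses : ∀ {s ss d} → AlmostEqual q s → All (AlmostEqual q) ss →
      q + (s + sum ss) ≡ suc m → q * 3 ≤ suc m → 36 ≤ suc m → length Bs + d ≡ q →
      Classes e q (2 + length ss) (As ++ Bs)
    twoMixedClasses {s} {ss} {d} eqs eqss total 3q≤ 36≤ Bs+d
      with room (length As) (length Bs) d {Δ = suc m / 12} (AlmostEqual⇒≤ eqs)
             (m/n*n≤m (suc m) 12) size Bs+d 3q≤ 36≤
    ... | t , As≡ , As≤
      -- The weight degree - 1 measures how many vertices of A, beyond |B₂| of them, can have a
      -- neighbour in `B₂`. The weight `leaves` counts vertices whose only neighbour lies in `B₂`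
      -- and which can therefore join `B₁`.
      with segment (λ b → degʳ b ∸ 1) leaves (suc m / 12) t d Bs
             (λ {b} b∈ → ≤-trans (m∸n≤m (degʳ b) 1)
                (≤-trans (≤-reflexive (sym (m*n/n≡m (degʳ b) 12)))
                   (/-monoˡ-≤ 12 (boundedʳ b∈))))
             light heavy
      where
      open ≤-Reasoning
      degʳ≡ : ∀ {b} → b ∈ Bs → degʳ b ≡ degʳ b ∸ 1 + 1
      degʳ≡ b∈ = sym (m∸n+n≡m (positiveʳ b∈))
      light : ∑ Bs (λ b → degʳ b ∸ 1) ≤ t + (t + t)
      light = ≤-trans (+-cancelʳ-≤ (length Bs) _ _ (begin
        ∑ Bs (λ b → degʳ b ∸ 1) + length Bs          ≡⟨ cong (∑ Bs (λ b → degʳ b ∸ 1) +_) (∑-1 Bs) ⟨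
        ∑ Bs (λ b → degʳ b ∸ 1) + ∑ Bs (λ _ → 1)     ≡⟨ ∑-+ Bs (λ b → degʳ b ∸ 1) (λ _ → 1) ⟨
        ∑ Bs (λ b → degʳ b ∸ 1 + 1)                  ≡⟨ ∑-cong Bs degʳ≡ ⟨
        ∑ Bs degʳ                                    ≡⟨ degʳ-∑ Bs ⟨
        ∑ As degˡ                                    ≤⟨ edges ⟩
        m                                            ≤⟨ n≤1+n m ⟩
        suc m                                        ≡⟨ size ⟨
        length As + length Bs                        ∎)) As≤
      heavy : length Bs + (d + (d + d)) ≤ ∑ Bs leaves
      heavy = enough (length As) (length Bs) d size Bs+d 3q≤ many-leaves
    ... | B₁ , B₂ , pB , ∑B₂ , leavesB₂ = assemble
      (split-at (length B₂ + d) F₁ (≤-trans leavesB₂ F₁-large))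
      (split-at (s ∸ length B₂) F₂ F₂-large)
      where
      open ≤-Reasoning
      near₁ near₂ : V → ℕ
      near₁ a = ∑ B₁ (e a)
      near₂ a = ∑ B₂ (e a)
      -- Choosing `F₂` inside `R₁` keeps the vertices added to the two classes disjoint. Nothing is
      -- lost: a vertex with no neighbour in `B₁` has one in `B₂`, because no vertex is isolated.
      F₁ R₁ F₂ R₂ : List V
      F₁ = filter (λ a → near₁ a ≟ 0) As
      R₁ = filter (∁? (λ a → near₁ a ≟ 0)) As
      F₂ = filter (λ a → near₂ a ≟ 0) R₁
      R₂ = filter (∁? (λ a → near₂ a ≟ 0)) R₁
      pA₁ : As ↭ F₁ ++ R₁
      pA₁ = ↭-filter (λ a → near₁ a ≟ 0) As
      pA₂ : R₁ ↭ F₂ ++ R₂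
      pA₂ = ↭-filter (λ a → near₂ a ≟ 0) R₁
      lenB : length Bs ≡ length B₁ + length B₂
      lenB = trans (↭-length pB) (length-++ B₁)
      degˡ≡ : ∀ a → degˡ a ≡ near₁ a + near₂ a
      degˡ≡ a = trans (∑-↭ (e a) pB) (∑-++ B₁ B₂ (e a))
      -- With `x` neighbours in `B₁` and `y` in `B₂`, this product is 1 for a leaf hanging from `B₂`
      -- and 0 otherwise.
      ≤1 : ∀ x y → y * (2 ∸ (x + y)) ≤ 1
      ≤1 x       0             = z≤n
      ≤1 zero    1             = ≤-refl
      ≤1 zero    (suc (suc y)) rewrite 0∸n≡0 y | *-zeroʳ y = z≤n
      ≤1 (suc x) (suc y)       rewrite +-suc x y | 0∸n≡0 (x + y) | *-zeroʳ y = z≤n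
      ≡0 : ∀ x y → x ≢ 0 → y * (2 ∸ (x + y)) ≡ 0
      ≡0 zero    y       x≢0 = contradiction refl x≢0
      ≡0 (suc x) 0       _   = refl
      ≡0 (suc x) (suc y) _   rewrite +-suc x y | 0∸n≡0 (x + y) = *-zeroʳ y
      F₁-large : ∑ B₂ leaves ≤ length F₁
      F₁-large = begin
        ∑ B₂ leaves                                    ≡⟨ ∑-leaves B₂ ⟩
        ∑ As (λ a → near₂ a * leaf a)                  ≡⟨ ∑-cong As (λ {a} _ → cong (λ x → near₂ a * (2 ∸ x)) (degˡ≡ a)) ⟩
        ∑ As (λ a → near₂ a * (2 ∸ (near₁ a + near₂ a))) ≤⟨ ∑≤length-filter _ (λ a → ≤1 (near₁ a) (near₂ a)) (λ {a} → ≡0 (near₁ a) (near₂ a)) As ⟩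
        length F₁                                      ∎
      F₁⊆ : ∀ {a} → a ∈ F₁ → a ∈ As × near₁ a ≡ 0
      F₁⊆ = ∈-filter⁻ (λ a → near₁ a ≟ 0)
      R₁⊆ : ∀ {a} → a ∈ R₁ → a ∈ As
      R₁⊆ = proj₁ ∘ ∈-filter⁻ (∁? (λ a → near₁ a ≟ 0))
      F₂⊆ : ∀ {a} → a ∈ F₂ → a ∈ As × near₂ a ≡ 0
      F₂⊆ a∈ = let a∈R , ≡0 = ∈-filter⁻ (λ a → near₂ a ≟ 0) a∈ in R₁⊆ a∈R , ≡0
      R₂⊆ : ∀ {a} → a ∈ R₂ → a ∈ As
      R₂⊆ = R₁⊆ ∘ proj₁ ∘ ∈-filter⁻ (∁? (λ a → near₂ a ≟ 0))
      ∑degB₂ : ∑ As near₂ ≤ t + suc m / 12 + length B₂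
      ∑degB₂ = begin
        ∑ As near₂                                   ≡⟨ degʳ-∑ B₂ ⟩
        ∑ B₂ degʳ                                    ≤⟨ ∑-mono B₂ (λ {b} _ → m≤n+m∸n (degʳ b) 1) ⟩
        ∑ B₂ (λ b → 1 + (degʳ b ∸ 1))                ≡⟨ ∑-+ B₂ (λ _ → 1) (λ b → degʳ b ∸ 1) ⟩
        ∑ B₂ (λ _ → 1) + ∑ B₂ (λ b → degʳ b ∸ 1)     ≡⟨ cong (_+ ∑ B₂ (λ b → degʳ b ∸ 1)) (∑-1 B₂) ⟩
        length B₂ + ∑ B₂ (λ b → degʳ b ∸ 1)          ≤⟨ +-monoʳ-≤ (length B₂) ∑B₂ ⟩
        length B₂ + (t + suc m / 12)                 ≡⟨ +-comm (length B₂) _ ⟩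
        t + suc m / 12 + length B₂                   ∎
      As-covered : length As ≤ length F₂ + ∑ As near₂
      As-covered = begin
        length As                                    ≡⟨ trans (↭-length pA₁) (length-++ F₁) ⟩
        length F₁ + length R₁                        ≡⟨ cong (length F₁ +_) (trans (↭-length pA₂) (length-++ F₂)) ⟩
        length F₁ + (length F₂ + length R₂)          ≤⟨ +-mono-≤ (≤-trans (≤-reflexive (sym (∑-1 F₁))) (∑-mono F₁ near)) (+-monoʳ-≤ (length F₂) (length-filter≤∑ _ n≢0⇒n>0 R₁)) ⟩
        ∑ F₁ near₂ + (length F₂ + ∑ R₁ near₂)        ≡⟨ regroup (∑ F₁ near₂) (length F₂) _ ⟩
        length F₂ + (∑ F₁ near₂ + ∑ R₁ near₂)        ≡⟨ cong (length F₂ +_) (trans (∑-↭ near₂ pA₁) (∑-++ F₁ R₁ near₂)) ⟨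
        length F₂ + ∑ As near₂                       ∎
        where
        regroup : ∀ a b c → a + (b + c) ≡ b + (a + c)
        regroup = solve-∀
        near : ∀ {a} → a ∈ F₁ → 1 ≤ near₂ a
        near {a} a∈ = let a∈As , ≡0 = F₁⊆ a∈ in
          ≤-trans (positiveˡ a∈As) (≤-reflexive (trans (degˡ≡ a) (cong (_+ near₂ a) ≡0)))
      F₂-large : s ∸ length B₂ ≤ length F₂
      F₂-large = m≤n+o⇒m∸n≤o s (length B₂) (+-cancelʳ-≤ (suc m / 12 + t) _ _ (begin
        s + (suc m / 12 + t)                         ≡⟨ +-assoc s _ t ⟨
        s + suc m / 12 + t                           ≡⟨ As≡ ⟨
        length As                                    ≤⟨ As-covered ⟩
        length F₂ + ∑ As near₂                       ≤⟨ +-monoʳ-≤ (length F₂) ∑degB₂ ⟩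
        length F₂ + (t + suc m / 12 + length B₂)     ≡⟨ regroup (length F₂) t _ (length B₂) ⟩
        length B₂ + length F₂ + (suc m / 12 + t)     ∎))
        where
        regroup : ∀ a b c d → a + (b + c + d) ≡ d + a + (c + b)
        regroup = solve-∀
      B₂≤s : length B₂ ≤ s
      B₂≤s = ≤-trans (≤-trans (m≤n+m (length B₂) (length B₁)) (≤-trans (≤-reflexive (sym lenB)) (m≤m+n _ d)))
                     (≤-trans (≤-reflexive Bs+d) (q≤s eqs))
        where
        q≤s : ∀ {s} → AlmostEqual q s → q ≤ s
        q≤s (inj₁ refl) = ≤-refl
        q≤s (inj₂ refl) = n≤1+n _
      B₁⊆ : ∀ {b} → b ∈ B₁ → b ∈ Bs
      B₁⊆ b∈ = ∈-resp-↭ (↭-sym pB) (∈-++⁺ˡ b∈)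
      B₂⊆ : ∀ {b} → b ∈ B₂ → b ∈ Bs
      B₂⊆ b∈ = ∈-resp-↭ (↭-sym pB) (∈-++⁺ʳ B₁ b∈)
      mixed : ∀ {Bs′ As′} → (∀ {b} → b ∈ Bs′ → b ∈ Bs) → (∀ {a} → a ∈ As′ → a ∈ As × ∑ Bs′ (e a) ≡ 0) →
              Independent e q (As′ ++ Bs′)
      mixed B⊆ A⊆ = independent-++ e q symmetric
        (λ p p′ → indepˡ (proj₁ (A⊆ p)) (proj₁ (A⊆ p′))) (λ p p′ → indepʳ (B⊆ p) (B⊆ p′))
        (λ {a} a∈ b∈ → ∑≡0⇒≡0 {f = e a} (proj₂ (A⊆ a∈)) b∈)
      assemble : (∃[ X₁ ] ∃[ Y₁ ] F₁ ≡ X₁ ++ Y₁ × length X₁ ≡ length B₂ + d) →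
                 (∃[ X₂ ] ∃[ Y₂ ] F₂ ≡ X₂ ++ Y₂ × length X₂ ≡ s ∸ length B₂) →
                 Classes e q (2 + length ss) (As ++ Bs)
      assemble (X₁ , Y₁ , eq₁ , len₁) (X₂ , Y₂ , eq₂ , len₂) =
        classes-↭ e q perm
          (classes-++ e q (singleClass e q (mixed {B₁} {X₁} B₁⊆ (λ a∈ → F₁⊆ (subst (_ ∈_) (sym eq₁) (∈-++⁺ˡ a∈)))) (inj₁ lenq))
          (classes-++ e q (singleClass e q (mixed {B₂} {X₂} B₂⊆ (λ a∈ → F₂⊆ (subst (_ ∈_) (sym eq₂) (∈-++⁺ˡ a∈))))
                                     (subst (AlmostEqual q) (sym lens) eqs))
          (chunk e q eqss rest (λ p p′ → indepˡ (rest⊆ p) (rest⊆ p′)) lenrest)))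
        where
        rest : List V
        rest = Y₁ ++ (Y₂ ++ R₂)
        rest⊆ : ∀ {a} → a ∈ rest → a ∈ As
        rest⊆ a∈ with ∈-++⁻ Y₁ a∈
        ... | inj₁ a∈Y₁ = proj₁ (F₁⊆ (subst (_ ∈_) (sym eq₁) (∈-++⁺ʳ X₁ a∈Y₁)))
        ... | inj₂ a∈′ with ∈-++⁻ Y₂ a∈′
        ... | inj₁ a∈Y₂ = proj₁ (F₂⊆ (subst (_ ∈_) (sym eq₂) (∈-++⁺ʳ X₂ a∈Y₂)))
        ... | inj₂ a∈R₂ = R₂⊆ a∈R₂
        lenq : length (X₁ ++ B₁) ≡ q
        lenq = trans (length-++ X₁) (trans (cong (_+ length B₁) len₁)
          (trans (regroup (length B₂) d (length B₁)) (trans (cong (_+ d) (sym lenB)) Bs+d)))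
          where
          regroup : ∀ a b c → a + b + c ≡ c + a + b
          regroup = solve-∀
        lens : length (X₂ ++ B₂) ≡ s
        lens = trans (length-++ X₂) (trans (cong (_+ length B₂) len₂) (m∸n+n≡m B₂≤s))
        perm : (X₁ ++ B₁) ++ ((X₂ ++ B₂) ++ rest) ↭ As ++ Bs
        perm = ↭-sym (↭-trans
          (++⁺ (↭-trans pA₁ (↭-trans (++⁺ (↭-reflexive eq₁) (↭-trans pA₂ (++⁺ʳ R₂ (↭-reflexive eq₂))))
                 (↭-trans (↭-reflexive (cong ((X₁ ++ Y₁) ++_) (++-assoc X₂ Y₂ R₂)))
                          (++-interchange X₁ Y₁ X₂ (Y₂ ++ R₂))))) pB)
          (↭-trans (↭-trans (↭-reflexive (++-assoc (X₁ ++ X₂) rest (B₁ ++ B₂)))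
                   (↭-trans (++⁺ˡ (X₁ ++ X₂) (++-comm rest (B₁ ++ B₂)))
                            (↭-reflexive (sym (++-assoc (X₁ ++ X₂) (B₁ ++ B₂) rest)))))
          (↭-trans (++⁺ʳ rest (++-interchange X₁ X₂ B₁ B₂))
                   (↭-reflexive (++-assoc (X₁ ++ B₁) (X₂ ++ B₂) rest)))))
        lenrest : length rest ≡ sum ss
        lenrest = +-cancelˡ-≡ (q + s) _ _ (trans (cong (_+ length rest) (cong₂ _+_ (sym lenq) (sym lens)))
          (trans (+-assoc (length (X₁ ++ B₁)) _ _) (trans (cong (length (X₁ ++ B₁) +_) (sym (length-++ (X₂ ++ B₂))))
          (trans (sym (length-++ (X₁ ++ B₁))) (trans (↭-length perm) (trans (length-++ As)
          (trans size (trans (sym total) (sym (+-assoc q s (sum ss)))))))))))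

  -- While more than `q` vertices remain to be cut off, there are at least q + 1 of them, so another
  -- whole class fits.
  cut : ∀ {sizes} → All (AlmostEqual q) sizes → ∀ α → α ≤ sum sizes + q →
        ∃[ s₁ ] ∃[ s₂ ] sizes ≡ s₁ ++ s₂ × All (AlmostEqual q) s₁ × All (AlmostEqual q) s₂ ×
                        sum s₁ ≤ α × α ≤ sum s₁ + q
  cut []                 α α≤ = [] , [] , refl , [] , [] , z≤n , α≤
  cut {s ∷ ss} (eq ∷ eqs) α α≤ with α ≤? q
  ... | yes α≤q = [] , s ∷ ss , refl , [] , eq ∷ eqs , z≤n , α≤q
  ... | no  α≰q with m≤n⇒∃[o]m+o≡n (≤-trans (AlmostEqual⇒≤ eq) (≰⇒> α≰q))
  ... | α′ , refl with cut eqs α′ (+-cancelˡ-≤ s _ _ (≤-trans α≤ (≤-reflexive (+-assoc s (sum ss) q))))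
  ... | s₁ , s₂ , refl , eq₁ , eq₂ , lo , hi = s ∷ s₁ , s₂ , refl , eq ∷ eq₁ , eq₂ ,
        +-monoʳ-≤ s lo , ≤-trans (+-monoʳ-≤ s hi) (≤-reflexive (sym (+-assoc s (sum s₁) q)))

  q≤sum : ∀ {s ss} → All (AlmostEqual q) (s ∷ ss) → q ≤ sum (s ∷ ss)
  q≤sum (inj₁ refl ∷ _) = m≤m+n q _
  q≤sum (inj₂ refl ∷ _) = ≤-trans (n≤1+n q) (m≤m+n (suc q) _)

  -- If both fail then R < 2 x and P < 2 y, whence P + R < 2 q.

  one-side-fits : ∀ P R x y {m} → q ≤ P → q ≤ R → x + y ≡ q → (P + x) + (R + y) ≡ suc m →
                  x * m ≤ R * (P + x) ⊎ y * m ≤ P * (R + y)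
  one-side-fits P R x y {m} q≤P q≤R refl total with x * m ≤? R * (P + x) | y * m ≤? P * (R + y)
  ... | yes p | _     = inj₁ p
  ... | no _  | yes p = inj₂ p
  ... | no ¬p | no ¬p′ = contradiction (+-mono-≤ q≤P q≤R) (<⇒≱ (begin-strict
      P + R             ≡⟨ +-comm P R ⟩
      R + P             <⟨ +-mono-< (half P R x y q≤P total (≰⇒> ¬p))
                                    (half R P y x (subst (_≤ R) (+-comm x y) q≤R)
                                       (trans (+-comm (R + y) (P + x)) total) (≰⇒> ¬p′)) ⟩
      (x + x) + (y + y) ≡⟨ regroup x y ⟩
      (x + y) + (x + y) ∎))
    where
    open ≤-Reasoning
    regroup : ∀ x y → (x + x) + (y + y) ≡ (x + y) + (x + y)
    regroup = solve-∀
    half : ∀ P R x y → x + y ≤ P → (P + x) + (R + y) ≡ suc m → R * (P + x) < x * m → R < x + x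
    half P R x y le total lt = *-cancelʳ-< P R (x + x) (+-cancelʳ-< (R * x) _ _ (begin-strict
      R * P + R * x               ≡⟨ *-distribˡ-+ R P x ⟨
      R * (P + x)                 <⟨ lt ⟩
      x * m                       ≤⟨ *-monoʳ-≤ x (n≤1+n m) ⟩
      x * suc m                   ≡⟨ cong (x *_) total ⟨
      x * ((P + x) + (R + y))     ≡⟨ id₁ P R x y ⟩
      x * P + x * (x + y) + R * x ≤⟨ +-monoˡ-≤ (R * x) (+-monoʳ-≤ (x * P) (*-monoʳ-≤ x le)) ⟩
      x * P + x * P + R * x       ≡⟨ cong (_+ R * x) (*-distribʳ-+ P x x) ⟨
      (x + x) * P + R * x         ∎))
      where
      id₁ : ∀ P R x y → x * ((P + x) + (R + y)) ≡ x * P + x * (x + y) + R * x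
      id₁ = solve-∀

  -- The summand `q` in front of the other sizes is the class to be shared. If the cut leaves one
  -- side without a whole class, that side is just its own share of this class, and the share of the
  -- other side becomes the deficit `d` in `twoMixedClasses`.
  colourClasses : ∀ {m As Bs} → Bipartite e q m As Bs → ∀ {s₁ s₂ ss} →
    All (AlmostEqual q) (s₁ ∷ s₂ ∷ ss) → q + sum (s₁ ∷ s₂ ∷ ss) ≡ suc m → q * 3 ≤ suc m → 36 ≤ suc m →
    Classes e q (suc (length (s₁ ∷ s₂ ∷ ss))) (As ++ Bs)
  colourClasses {m} {As} {Bs} G {s₁} {s₂} {ss} eqs total 3q≤ 36≤
    with cut eqs (length As) (≤-trans (m+n≤o⇒m≤o _ (≤-reflexive (Bipartite.size G)))
                                      (≤-reflexive (trans (sym total) (+-comm q _))))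
  ... | t₁ , t₂ , split , eqs₁ , eqs₂ , lo , hi
    with m≤n⇒∃[o]m+o≡n lo
  ... | x , A≡ with m≤n⇒∃[o]m+o≡n (+-cancelˡ-≤ (sum t₁) _ _ (≤-trans (≤-reflexive A≡) hi))
  ... | y , x+y = go t₁ t₂ split eqs₁ eqs₂ A≡ B≡
    where
    open Bipartite G
    open ≡-Reasoning
    B≡ : length Bs ≡ sum t₂ + y
    B≡ = +-cancelˡ-≡ (length As) _ _ (begin
      length As + length Bs          ≡⟨ trans size (sym total) ⟩
      q + sum (s₁ ∷ s₂ ∷ ss)         ≡⟨ cong₂ _+_ (sym x+y) (trans (cong sum split) (sum-++ t₁ t₂)) ⟩
      x + y + (sum t₁ + sum t₂)      ≡⟨ regroup x y (sum t₁) (sum t₂) ⟩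
      sum t₁ + x + (sum t₂ + y)      ≡⟨ cong (_+ (sum t₂ + y)) A≡ ⟩
      length As + (sum t₂ + y)       ∎)
      where
      regroup : ∀ x y a b → x + y + (a + b) ≡ a + x + (b + y)
      regroup = solve-∀
    k≡ : ∀ t₁ t₂ → s₁ ∷ s₂ ∷ ss ≡ t₁ ++ t₂ → length t₁ + length t₂ ≡ length (s₁ ∷ s₂ ∷ ss)
    k≡ t₁ t₂ split = trans (sym (length-++ t₁)) (cong length (sym split))
    fitˡ : ∀ t₁ t₂ → s₁ ∷ s₂ ∷ ss ≡ t₁ ++ t₂ → All (AlmostEqual q) t₁ → All (AlmostEqual q) t₂ →
           sum t₁ + x ≡ length As → length Bs ≡ sum t₂ + y → x * m ≤ sum t₂ * length As →
           Classes e q (suc (length (s₁ ∷ s₂ ∷ ss))) (As ++ Bs)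
    fitˡ t₁ t₂ split eqs₁ eqs₂ A≡ B≡ le = subst (λ k → Classes e q (suc k) (As ++ Bs)) (k≡ t₁ t₂ split)
      (oneMixedClass e q G eqs₁ eqs₂ (sym A≡) B≡ x+y le)
    fitʳ : ∀ t₁ t₂ → s₁ ∷ s₂ ∷ ss ≡ t₁ ++ t₂ → All (AlmostEqual q) t₁ → All (AlmostEqual q) t₂ →
           sum t₁ + x ≡ length As → length Bs ≡ sum t₂ + y → y * m ≤ sum t₁ * length Bs →
           Classes e q (suc (length (s₁ ∷ s₂ ∷ ss))) (As ++ Bs)
    fitʳ t₁ t₂ split eqs₁ eqs₂ A≡ B≡ le = classes-↭ e q (++-comm Bs As)
      (subst (λ k → Classes e q (suc k) (Bs ++ As)) (trans (+-comm (length t₂) (length t₁)) (k≡ t₁ t₂ split))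
        (oneMixedClass e q (flip e q G) eqs₂ eqs₁ B≡ (sym A≡) (trans (+-comm y x) x+y) le))
    go : ∀ t₁ t₂ → s₁ ∷ s₂ ∷ ss ≡ t₁ ++ t₂ → All (AlmostEqual q) t₁ → All (AlmostEqual q) t₂ →
         sum t₁ + x ≡ length As → length Bs ≡ sum t₂ + y →
         Classes e q (suc (length (s₁ ∷ s₂ ∷ ss))) (As ++ Bs)
    go [] _ refl _ (eq₁ ∷ eqs) A≡ B≡ =
      classes-↭ e q (++-comm Bs As) (twoMixedClasses (flip e q G) eq₁ eqs total 3q≤ 36≤
        (trans (cong (_+ y) (sym A≡)) x+y))
    go t₁@(_ ∷ _) [] split eqs₁ _ A≡ B≡ with trans split (++-identityʳ t₁) | eqs₁
    ... | refl | eq₁ ∷ eqs₁′ = twoMixedClasses G eq₁ eqs₁′ total 3q≤ 36≤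
        (trans (cong (_+ x) B≡) (trans (+-comm y x) x+y))
    go t₁@(_ ∷ _) t₂@(_ ∷ _) split eqs₁ eqs₂ A≡ B≡
      with one-side-fits (sum t₁) (sum t₂) x y (q≤sum eqs₁) (q≤sum eqs₂) x+y
             (trans (cong₂ _+_ A≡ (sym B≡)) size)
    ... | inj₁ le = fitˡ t₁ t₂ split eqs₁ eqs₂ A≡ B≡ (≤-trans le (≤-reflexive (cong (sum t₂ *_) A≡)))
    ... | inj₂ le = fitʳ t₁ t₂ split eqs₁ eqs₂ A≡ B≡ (≤-trans le (≤-reflexive (cong (sum t₁ *_) (sym B≡))))

-- From partitions into classes to balanced colourings of rooted trees

unique-disjoint : ∀ (xs : List X) {ys x} → Unique (xs ++ ys) → x ∈ xs → x ∈ ys → ⊥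
unique-disjoint (_ ∷ xs) (p ∷ _) (here refl) x∈ys = All.lookup p (∈-++⁺ʳ xs x∈ys) refl
unique-disjoint (_ ∷ xs) (_ ∷ u) (there x∈)  x∈ys = unique-disjoint xs u x∈ x∈ys

unique-++ʳ : ∀ (xs : List X) {ys} → Unique (xs ++ ys) → Unique ys
unique-++ʳ []       u       = u
unique-++ʳ (_ ∷ xs) (_ ∷ u) = unique-++ʳ xs u

unique-↭ : ∀ {xs ys : List X} → xs ↭ ys → Unique xs → Unique ys
unique-↭ p = ↭ₛ.Unique-resp-↭ (setoid _) (↭⇒↭ₛ p)

filter-cong-∈ : ∀ {P Q : X → Set} (P? : Decidable P) (Q? : Decidable Q) xs →
                (∀ {x} → x ∈ xs → P x → Q x) → (∀ {x} → x ∈ xs → Q x → P x) →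
                filter P? xs ≡ filter Q? xs
filter-cong-∈ P? Q? []       to from = refl
filter-cong-∈ P? Q? (x ∷ xs) to from with P? x | Q? x
... | yes p | yes q = cong (x ∷_) (filter-cong-∈ P? Q? xs (to ∘ there) (from ∘ there))
... | no ¬p | no ¬q = filter-cong-∈ P? Q? xs (to ∘ there) (from ∘ there)
... | yes p | no ¬q = contradiction (to (here refl) p) ¬q
... | no ¬p | yes q = contradiction (from (here refl) q) ¬p

module _ {n : ℕ} where

  position : List (List (Fin n)) → Fin n → ℕ
  position []       v = 0
  position (L ∷ Ls) v with _∈?_ Fin._≟_ v L
  ... | yes _ = 0
  ... | no  _ = suc (position Ls v)

  position-∈ : ∀ L Ls {v} → v ∈ L → position (L ∷ Ls) v ≡ 0
  position-∈ L Ls {v} v∈ with _∈?_ Fin._≟_ v L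
  ... | yes _ = refl
  ... | no v∉ = contradiction v∈ v∉

  position-∉ : ∀ L Ls {v} → ¬ v ∈ L → position (L ∷ Ls) v ≡ suc (position Ls v)
  position-∉ L Ls {v} v∉ with _∈?_ Fin._≟_ v L
  ... | yes v∈ = contradiction v∈ v∉
  ... | no _ = refl

  position< : ∀ Ls {v} → v ∈ concat Ls → position Ls v < length Ls
  position< (L ∷ Ls) {v} v∈ with _∈?_ Fin._≟_ v L
  ... | yes _ = s≤s z≤n
  ... | no v∉ with ∈-++⁻ L v∈
  ... | inj₁ v∈L = contradiction v∈L v∉
  ... | inj₂ v∈′ = s≤s (position< Ls v∈′)

  position-class : ∀ Ls {P : List (Fin n) → Set} → All P Ls → ∀ {u v} → u ∈ concat Ls → v ∈ concat Ls →
                   position Ls u ≡ position Ls v → ∃[ L ] P L × u ∈ L × v ∈ L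
  position-class (L ∷ Ls) (p ∷ ps) {u} {v} u∈ v∈ eq
    with _∈?_ Fin._≟_ u L | _∈?_ Fin._≟_ v L
  ... | yes u∈L | yes v∈L = L , p , u∈L , v∈L
  ... | no u∉L  | no v∉L with ∈-++⁻ L u∈ | ∈-++⁻ L v∈
  ... | inj₁ u∈L | _ = contradiction u∈L u∉L
  ... | inj₂ _ | inj₁ v∈L = contradiction v∈L v∉L
  ... | inj₂ u∈′ | inj₂ v∈′ = position-class Ls ps u∈′ v∈′ (suc-injective eq)

  count-position : ∀ Ls → Unique (concat Ls) → (i : Fin (length Ls)) →
    length (filter (λ v → position Ls v ≟ toℕ i) (concat Ls)) ≡ length (lookup Ls i)
  count-position (L ∷ Ls) uniq i = trans (cong length (filter-++ P? L (concat Ls)))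
    (trans (length-++ (filter P? L)) (cases i))
    where
    P? : Decidable (λ v → position (L ∷ Ls) v ≡ toℕ i)
    P? v = position (L ∷ Ls) v ≟ toℕ i
    late : ∀ {v} → v ∈ concat Ls → position (L ∷ Ls) v ≡ suc (position Ls v)
    late v∈ = position-∉ L Ls (λ v∈L → unique-disjoint L uniq v∈L v∈)
    cases : ∀ i → length (filter (λ v → position (L ∷ Ls) v ≟ toℕ i) L) +
                  length (filter (λ v → position (L ∷ Ls) v ≟ toℕ i) (concat Ls)) ≡ length (lookup (L ∷ Ls) i)
    cases zero    = trans (cong₂ (λ xs ys → length xs + length ys)
      (filter-all (λ v → position (L ∷ Ls) v ≟ 0) {L} (All.tabulate (position-∈ L Ls)))
      (filter-none (λ v → position (L ∷ Ls) v ≟ 0) {concat Ls}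
         (All.tabulate (λ v∈ eq → case trans (sym (late v∈)) eq of λ ()))))
      (+-identityʳ (length L))
    cases (suc i) = trans (cong₂ (λ xs ys → length xs + length ys)
      (filter-none (λ v → position (L ∷ Ls) v ≟ suc (toℕ i)) {L}
         (All.tabulate (λ v∈ eq → case trans (sym (position-∈ L Ls v∈)) eq of λ ())))
      (filter-cong-∈ (λ v → position (L ∷ Ls) v ≟ suc (toℕ i)) (λ v → position Ls v ≟ toℕ i) (concat Ls)
         (λ v∈ eq → suc-injective (trans (sym (late v∈)) eq))
         (λ v∈ eq → trans (late v∈) (cong suc eq))))
      (count-position Ls (unique-++ʳ L uniq) i)

  indicator : Graph n → Fin n → Fin n → ℕ
  indicator G u v = if Graph.adj G u v then 1 else 0

  indicator≡1 : ∀ (G : Graph n) {u v} → Graph.Adj G u v → indicator G u v ≡ 1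
  indicator≡1 G {u} {v} uv with Graph.adj G u v
  ... | true = refl

  indicator≡0 : ∀ (G : Graph n) {u v} → ¬ Graph.Adj G u v → indicator G u v ≡ 0
  indicator≡0 G {u} {v} ¬uv with Graph.adj G u v
  ... | true  = contradiction _ ¬uv
  ... | false = refl

  classes⇒balanced : ∀ (G : Graph n) {q k} → Classes (indicator G) q k (allFin n) → StronglyBalanced k G
  classes⇒balanced G {q} (Ls , perm , all , refl) = record
    { colour   = colour
    ; proper   = λ u v uv eq → case position-class Ls all (covered u) (covered v)
                   (trans (sym (toℕ-fromℕ< (position< Ls (covered u))))
                     (trans (cong toℕ eq) (toℕ-fromℕ< (position< Ls (covered v))))) of
                   λ { (L , (ind , _) , u∈ , v∈) → case trans (sym (indicator≡1 G uv)) (ind u∈ v∈) of λ () }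
    ; balanced = λ i j _ → close (size i) (size j)
    }
    where
    covered : ∀ v → v ∈ concat Ls
    covered v = ∈-resp-↭ (↭-sym perm) (∈-allFin v)
    colour : Fin n → Fin (length Ls)
    colour v = fromℕ< (position< Ls (covered v))
    classSize≡ : ∀ i → classSize colour i ≡ length (lookup Ls i)
    classSize≡ i = trans (cong length (filter-cong-∈ (λ v → colour v Fin.≟ i) (λ v → position Ls v ≟ toℕ i) (allFin n)
        (λ {v} _ eq → trans (sym (toℕ-fromℕ< (position< Ls (covered v)))) (cong toℕ eq))
        (λ {v} _ eq → toℕ-injective (trans (toℕ-fromℕ< (position< Ls (covered v))) eq))))
      (trans (↭-length (filter-↭ (λ v → position Ls v ≟ toℕ i) (↭-sym perm)))
        (count-position Ls (unique-↭ (↭-sym perm) (allFin⁺ n)) i))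
    size : ∀ i → AlmostEqual q (classSize colour i)
    size i = subst (AlmostEqual q) (sym (classSize≡ i)) (proj₂ (lookupAll all i))
      where
      lookupAll : ∀ {P : List (Fin n) → Set} {Ls} → All P Ls → ∀ i → P (lookup Ls i)
      lookupAll (p ∷ ps) zero    = p
      lookupAll (p ∷ ps) (suc i) = lookupAll ps i
    ∣1+n-n∣ : ∀ n → ∣ suc n - n ∣ ≤ 1
    ∣1+n-n∣ zero    = ≤-refl
    ∣1+n-n∣ (suc n) = ∣1+n-n∣ n
    close : ∀ {s t} → AlmostEqual q s → AlmostEqual q t → ∣ s - t ∣ ≤ 1
    close (inj₁ refl) (inj₁ refl) = ≤-trans (≤-reflexive (∣n-n∣≡0 q)) z≤n
    close (inj₁ refl) (inj₂ refl) = ≤-trans (≤-reflexive (∣-∣-comm q (suc q))) (∣1+n-n∣ q)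
    close (inj₂ refl) (inj₁ refl) = ∣1+n-n∣ q
    close (inj₂ refl) (inj₂ refl) = ≤-trans (≤-reflexive (∣n-n∣≡0 q)) z≤n

  -- The absence of cycles in a usable form: by `edge`, every edge joins a vertex to its parent.
  record Rooting (G : Graph n) (r : Fin n) : Set where
    field
      par        : Fin n → Fin n
      depth      : Fin n → ℕ
      depth-root : depth r ≡ 0
      par-root   : par r ≡ r
      depth-par  : ∀ {x} → x ≢ r → depth x ≡ suc (depth (par x))
      adj-par    : ∀ {x} → x ≢ r → Graph.Adj G x (par x)
      edge       : ∀ {x y} → Graph.Adj G x y → par x ≡ y ⊎ par y ≡ x

  degree : Graph n → Fin n → ℕ
  degree G v = ∑ (allFin n) (indicator G v)

side : ℕ → Bool
side zero    = true
side (suc d) = not (side d)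

≤-∑ : ∀ {xs : List X} {x} (f : X → ℕ) → x ∈ xs → f x ≤ ∑ xs f
≤-∑ {xs = x ∷ xs} f (here refl) = m≤m+n (f x) _
≤-∑ {xs = x ∷ xs} f (there y∈)  = ≤-trans (≤-∑ f y∈) (m≤n+m _ (f x))

∑-δ : ∀ {n} (z : Fin n) c (xs : List (Fin n)) → Unique xs →
      ∑ xs (λ y → if does (z Fin.≟ y) then c else 0) ≤ c
∑-δ z c [] _ = z≤n
∑-δ z c (x ∷ xs) (x∉ ∷ u) with z Fin.≟ x
... | yes refl = ≤-reflexive (trans (cong (c +_) (rest xs x∉)) (+-identityʳ c))
  where
  rest : ∀ xs → All (z ≢_) xs → ∑ xs (λ y → if does (z Fin.≟ y) then c else 0) ≡ 0
  rest []       _        = refl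
  rest (y ∷ ys) (z≢ ∷ p) with z Fin.≟ y
  ... | yes eq = contradiction eq z≢
  ... | no  _  = rest ys p
... | no _ = ∑-δ z c xs u

-- A parent edge changes the depth by one. The only exception would be the root, which is its own
-- parent, and there the edge would be a loop.
side-step : ∀ {n} {G : Graph n} {r} (R : Rooting G r) → let open Rooting R in
  (∀ {x} → ¬ Graph.Adj G x x) → ∀ {x y} → Graph.Adj G x y → side (depth x) ≡ not (side (depth y))
side-step {G = G} {r} R irr {x} {y} xy with Rooting.edge R xy
... | inj₁ refl = cong side (Rooting.depth-par R λ x≡r → irr (subst (Graph.Adj G x)
        (trans (cong (Rooting.par R) x≡r) (trans (Rooting.par-root R) (sym x≡r))) xy))
... | inj₂ refl = trans (sym (Bool.not-involutive _)) (cong not (sym (cong side (Rooting.depth-par R λ y≡r →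
        irr (subst (λ z → Graph.Adj G z y)
          (trans (cong (Rooting.par R) y≡r) (trans (Rooting.par-root R) (sym y≡r))) xy)))))

module _ {m : ℕ} (G : Graph (suc m)) (r : Fin (suc m)) (R : Rooting G r)
         (connected : ∀ u v → Star (Graph.Adj G) u v) (1≤m : 1 ≤ m)
         (bounded : ∀ v → degree G v * 12 ≤ suc m) where
  open Rooting R
  private
    open Graph G using (adj; Adj)
    N : List (Fin (suc m))
    N = allFin (suc m)
    e : Fin (suc m) → Fin (suc m) → ℕ
    e = indicator G
    E? : Decidable (λ x → side (depth x) ≡ true)
    E? x = side (depth x) Bool.≟ true
    As Bs : List (Fin (suc m))
    As = filter E? N
    Bs = filter (∁? E?) N
    perm : As ++ Bs ↭ N
    perm = ↭-sym (↭-filter E? N)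

    symm : ∀ x y → e x y ≡ e y x
    symm x y = cong (λ b → if b then 1 else 0) (Graph.symmetric G x y)

    irr : ∀ {x} → ¬ Adj x x
    irr {x} p = subst T (Graph.irreflexive G x) p

    sideA : ∀ {a} → a ∈ As → side (depth a) ≡ true
    sideA a∈ = proj₂ (∈-filter⁻ E? {xs = N} a∈)

    sideB : ∀ {b} → b ∈ Bs → side (depth b) ≡ false
    sideB b∈ = Bool.¬-not (proj₂ (∈-filter⁻ (∁? E?) {xs = N} b∈))

    neighbour : ∀ x → ∃[ y ] Adj x y
    neighbour x = first (connected x (proj₁ (other 1≤m x))) (proj₂ (other 1≤m x))
      where
      other : ∀ {m} → 1 ≤ m → (x : Fin (suc m)) → ∃[ y ] x ≢ y
      other (s≤s _) zero    = suc zero , λ ()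
      other _       (suc _) = zero , λ ()
      first : ∀ {y} → Star Adj x y → x ≢ y → ∃[ z ] Adj x z
      first ε          x≢x = contradiction refl x≢x
      first (xz ◅ _) _   = _ , xz

    in-As : ∀ {x} → side (depth x) ≡ true → x ∈ As
    in-As eq = ∈-filter⁺ E? (∈-allFin _) eq

    in-Bs : ∀ {x} → side (depth x) ≡ false → x ∈ Bs
    in-Bs eq = ∈-filter⁺ (∁? E?) (∈-allFin _) (λ eq′ → case trans (sym eq) eq′ of λ ())

    positive : ∀ {x xs} → (∀ {y} → Adj x y → y ∈ xs) → 1 ≤ ∑ xs (e x)
    positive {x} adj∈ = let y , xy = neighbour x in
      ≤-trans (≤-reflexive (sym (indicator≡1 G xy))) (≤-∑ (e x) (adj∈ xy))

    part-bounded : ∀ x → ∑ As (e x) * 12 ≤ suc m × ∑ Bs (e x) * 12 ≤ suc m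
    part-bounded x = ≤-trans (*-monoˡ-≤ 12 (≤-trans (m≤m+n (∑ As (e x)) (∑ Bs (e x))) (≤-reflexive eq))) (bounded x) ,
                     ≤-trans (*-monoˡ-≤ 12 (≤-trans (m≤n+m (∑ Bs (e x)) (∑ As (e x))) (≤-reflexive eq))) (bounded x)
      where
      eq : ∑ As (e x) + ∑ Bs (e x) ≡ degree G x
      eq = trans (sym (∑-++ As Bs (e x))) (∑-↭ (e x) perm)

    independent : ∀ {b x y} → side (depth x) ≡ b → side (depth y) ≡ b → e x y ≡ 0
    independent {b} {x} {y} eq eq′ = indicator≡0 G λ xy → Bool.not-¬ {b} refl
      (trans (sym eq′) (trans (sym (Bool.not-involutive _)) (cong not (trans (sym (side-step R irr xy)) eq))))

    -- Every edge is charged to whichever of its endpoints is the child.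

    charge : Fin (suc m) → ℕ
    charge x = if does (x Fin.≟ r) then 0 else 1

    charged-up : ∀ x y → par x ≡ y → x ≢ y → 1 ≤ (if does (par x Fin.≟ y) then charge x else 0)
    charged-up x y p x≢y with par x Fin.≟ y | x Fin.≟ r
    ... | no ¬p | _         = contradiction p ¬p
    ... | yes _ | no _      = ≤-refl
    ... | yes _ | yes refl  = contradiction (trans (sym par-root) p) x≢y

    charged : ∀ x y → e x y ≤ (if does (par x Fin.≟ y) then charge x else 0) +
                              (if does (par y Fin.≟ x) then charge y else 0)
    charged x y with adj x y in eq
    ... | false = z≤n
    ... | true with edge {x} {y} (subst T (sym eq) _)
    ... | inj₁ p = ≤-trans (charged-up x y p (λ x≡y → irr (subst (Adj x) (sym x≡y) (subst T (sym eq) _)))) (m≤m+n _ _)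
    ... | inj₂ p = ≤-trans (charged-up y x p (λ y≡x → irr (subst (Adj x) y≡x (subst T (sym eq) _)))) (m≤n+m _ _)

    edge-count : ∑ As (λ a → ∑ Bs (e a)) ≤ m
    edge-count = begin
      ∑ As (λ a → ∑ Bs (e a))                                   ≤⟨ ∑-mono As (λ {a} _ → ∑-mono Bs (λ {b} _ → charged a b)) ⟩
      ∑ As (λ a → ∑ Bs (λ b → up a b + up b a))                 ≡⟨ ∑-cong As (λ {a} _ → ∑-+ Bs (up a) (λ b → up b a)) ⟩
      ∑ As (λ a → ∑ Bs (up a) + ∑ Bs (λ b → up b a))            ≡⟨ ∑-+ As _ _ ⟩
      ∑ As (λ a → ∑ Bs (up a)) + ∑ As (λ a → ∑ Bs (λ b → up b a)) ≡⟨ cong (∑ As (λ a → ∑ Bs (up a)) +_) (∑-swap As Bs (λ a b → up b a)) ⟩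
      ∑ As (λ a → ∑ Bs (up a)) + ∑ Bs (λ b → ∑ As (up b))       ≤⟨ +-mono-≤ (∑-mono As (λ {a} _ → ∑-δ (par a) (charge a) Bs (filter⁺ (∁? E?) (allFin⁺ (suc m)))))
                                                                            (∑-mono Bs (λ {b} _ → ∑-δ (par b) (charge b) As (filter⁺ E? (allFin⁺ (suc m))))) ⟩
      ∑ As charge + ∑ Bs charge                                 ≡⟨ trans (sym (∑-++ As Bs charge)) (∑-↭ charge perm) ⟩
      ∑ N charge                                                ≤⟨ +-cancelʳ-≤ 1 _ _ root-free ⟩
      m                                                         ∎
      where
      open ≤-Reasoning
      up : Fin (suc m) → Fin (suc m) → ℕ
      up x y = if does (par x Fin.≟ y) then charge x else 0
      δ : Fin (suc m) → ℕ
      δ x = if does (x Fin.≟ r) then 1 else 0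
      δr : 1 ≤ δ r
      δr with r Fin.≟ r
      ... | yes _  = ≤-refl
      ... | no r≢r = contradiction refl r≢r
      charge+δ : ∀ x → charge x + δ x ≡ 1
      charge+δ x with x Fin.≟ r
      ... | yes _ = refl
      ... | no _  = refl
      -- The root is charged nothing; this turns the number n of vertices into the bound n - 1.
      root-free : ∑ N charge + 1 ≤ m + 1
      root-free = begin
        ∑ N charge + 1              ≤⟨ +-monoʳ-≤ (∑ N charge) (≤-trans δr (≤-∑ δ (∈-allFin r))) ⟩
        ∑ N charge + ∑ N δ          ≡⟨ ∑-+ N charge δ ⟨
        ∑ N (λ x → charge x + δ x)  ≡⟨ ∑-cong N (λ {x} _ → charge+δ x) ⟩
        ∑ N (λ _ → 1)               ≡⟨ ∑-1 N ⟩
        length N                    ≡⟨ length-tabulate (λ x → x) ⟩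
        suc m                       ≡⟨ +-comm 1 m ⟩
        m + 1                       ∎

  bipartite : ∀ q → ∃[ As ] ∃[ Bs ] (As ++ Bs ↭ allFin (suc m)) × Bipartite (indicator G) q m As Bs
  bipartite q = As , Bs , perm , record
    { symmetric = symm
    ; size      = trans (sym (length-++ As)) (trans (↭-length perm) (length-tabulate (λ x → x)))
    ; edges     = edge-count
    ; indepˡ    = λ x∈ y∈ → independent (sideA x∈) (sideA y∈)
    ; indepʳ    = λ x∈ y∈ → independent (sideB x∈) (sideB y∈)
    ; positiveˡ = λ a∈ → positive λ ab → in-Bs (trans (sym (Bool.not-involutive _))
                    (cong not (trans (sym (side-step R irr ab)) (sideA a∈))))
    ; positiveʳ = λ b∈ → positive λ ba → in-As (trans (sym (Bool.not-involutive _))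
                    (cong not (trans (sym (side-step R irr ba)) (sideB b∈))))
    ; boundedˡ  = λ {a} _ → proj₂ (part-bounded a)
    ; boundedʳ  = λ {b} _ → proj₁ (part-bounded b)
    }

class-sizes : ∀ q r l → r ≤ l → ∃[ sizes ] All (AlmostEqual q) sizes × length sizes ≡ l × sum sizes ≡ r + l * q
class-sizes q zero    zero    _         = [] , [] , refl , refl
class-sizes q zero    (suc l) _         with class-sizes q 0 l z≤n
... | ss , eqs , refl , sum≡ = q ∷ ss , inj₁ refl ∷ eqs , refl , cong (q +_) sum≡
class-sizes q (suc r) (suc l) (s≤s r≤l) with class-sizes q r l r≤l
... | ss , eqs , refl , sum≡ = suc q ∷ ss , inj₂ refl ∷ eqs , refl ,
      cong suc (trans (cong (q +_) sum≡) (regroup q r _))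
  where
  regroup : ∀ a b c → a + (b + c) ≡ b + (a + c)
  regroup = solve-∀

bounded⇒balanced : ∀ {m} k (G : Graph (suc m)) {r} → Rooting G r →
  (∀ u v → Star (Graph.Adj G) u v) → (∀ v → degree G v * 12 ≤ suc m) → 3 ≤ k → 36 ≤ suc m →
  StronglyBalanced k G
bounded⇒balanced {m} (suc (suc (suc k))) G R connected bounded (s≤s (s≤s (s≤s z≤n))) 36≤
  -- The remainder is less than the number of colours, so all larger classes fit among the others
  -- and at least one class, the one to be shared, has size exactly `q`.
  with class-sizes (suc m / (3 + k)) (suc m % (3 + k)) (2 + k) (≤-pred (m%n<n (suc m) (3 + k)))
     | bipartite G _ R connected (≤-trans (s≤s z≤n) (≤-pred 36≤)) bounded (suc m / (3 + k))
... | s₁ ∷ s₂ ∷ ss , eqs , refl , sum≡ | As , Bs , perm , B =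
  classes⇒balanced G (classes-↭ (indicator G) _ perm (colourClasses (indicator G) _ B eqs total three 36≤))
  where
  q : ℕ
  q = suc m / (3 + length ss)
  total : q + sum (s₁ ∷ s₂ ∷ ss) ≡ suc m
  total = trans (cong (q +_) sum≡) (trans (regroup q (suc m % (3 + length ss)) ((2 + length ss) * q))
            (trans (cong (suc m % (3 + length ss) +_) (*-comm (3 + length ss) q))
                   (sym (m≡m%n+[m/n]*n (suc m) (3 + length ss)))))
    where
    regroup : ∀ a b c → a + (b + c) ≡ b + (a + c)
    regroup = solve-∀
  three : q * 3 ≤ suc m
  three = ≤-trans (*-monoʳ-≤ q (s≤s (s≤s (s≤s z≤n)))) (m/n*n≤m (suc m) (3 + length ss))

-- Trees and parent functions

least : ∀ {P : ℕ → Set} (P? : Decidable P) k i → P (i + k) → (∀ j → j < i → ¬ P j) →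
        ∃[ l ] P l × (∀ j → j < l → ¬ P j)
least P? k i p below with P? i
... | yes pᵢ = i , pᵢ , below
least {P} P? zero    i p below | no ¬pᵢ = contradiction (subst P (+-identityʳ i) p) ¬pᵢ
least {P} P? (suc k) i p below | no ¬pᵢ = least P? k (suc i) (subst P (+-suc i k) p) below′
  where
  below′ : ∀ j → j < suc i → ¬ P j
  below′ j j<1+i with m<1+n⇒m<n∨m≡n j<1+i
  ... | inj₁ j<i  = below j j<i
  ... | inj₂ refl = ¬pᵢ

module _ {n : ℕ} (G : Graph n) (tree : IsTree G) (r : Fin n) where
  open Graph G using (Adj; adj)
  open IsTree tree

  private
    Walk : ℕ → Fin n → Set
    Walk zero    x = x ≡ r
    Walk (suc l) x = ∃[ y ] Adj x y × Walk l y

    walk? : ∀ l x → Dec (Walk l x)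
    walk? zero    x = x Fin.≟ r
    walk? (suc l) x = any? (λ y → T? (adj x y) ×-dec walk? l y)

    walk : ∀ {x} → Star Adj x r → ∃[ l ] Walk l x
    walk ε         = 0 , refl
    walk (xy ◅ ys) = let l , w = walk ys in suc l , _ , xy , w

    shortest : ∀ x → ∃[ l ] Walk l x × (∀ j → j < l → ¬ Walk j x)
    shortest x = let l , w = walk (connected x r) in least (λ l → walk? l x) l 0 w λ _ ()

    depth : Fin n → ℕ
    depth x = proj₁ (shortest x)

    depth≤ : ∀ {x l} → Walk l x → depth x ≤ l
    depth≤ {x} {l} w with depth x ≤? l
    ... | yes ≤ = ≤
    ... | no ≰  = contradiction w (proj₂ (proj₂ (shortest x)) l (≰⇒> ≰))

    step : ∀ {x} → x ≢ r → ∃[ y ] Adj x y × depth x ≡ suc (depth y)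
    step {x} x≢r = go (depth x) refl (proj₁ (proj₂ (shortest x)))
      where
      go : ∀ d → depth x ≡ d → Walk d x → ∃[ y ] Adj x y × depth x ≡ suc (depth y)
      go zero    _  x≡r           = contradiction x≡r x≢r
      go (suc d) eq (y , xy , w) = y , xy , ≤-antisym
        (depth≤ (y , xy , proj₁ (proj₂ (shortest y)))) (≤-trans (s≤s (depth≤ w)) (≤-reflexive (sym eq)))

    up : ∀ x → Dec (x ≡ r) → Fin n
    up x (yes _)  = r
    up x (no x≢r) = proj₁ (step x≢r)

    par : Fin n → Fin n
    par x = up x (x Fin.≟ r)

    par-root : par r ≡ r
    par-root with r Fin.≟ r
    ... | yes _  = refl
    ... | no r≢r = contradiction refl r≢r

    up-step : ∀ {x} r? → x ≢ r → Adj x (up x r?) × depth x ≡ suc (depth (up x r?))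
    up-step (yes x≡r) x≢r = contradiction x≡r x≢r
    up-step (no x≢r)  _   = proj₂ (step x≢r)

    adj-par : ∀ {x} → x ≢ r → Adj x (par x)
    adj-par {x} x≢r = proj₁ (up-step (x Fin.≟ r) x≢r)

    depth-par : ∀ {x} → x ≢ r → depth x ≡ suc (depth (par x))
    depth-par {x} x≢r = proj₂ (up-step (x Fin.≟ r) x≢r)

    depth-root : depth r ≡ 0
    depth-root = n≤0⇒n≡0 (depth≤ {r} refl)

    ParentEdge : Fin n → Fin n → Set
    ParentEdge x y = Adj x y × (par x ≡ y ⊎ par y ≡ x)

    adj-sym : ∀ {x y} → Adj x y → Adj y x
    adj-sym {x} {y} = subst T (Graph.symmetric G x y)

    data Path : Fin n → List (Fin n) → Fin n → Set where
      []  : ∀ {x} → Path x [] x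
      _∷_ : ∀ {x y z vs} → ParentEdge x y → Path y vs z → Path x (y ∷ vs) z

    snoc : ∀ {x vs y z} → Path x vs y → ParentEdge y z → Path x (vs ∷ʳ z) z
    snoc []      f = f ∷ []
    snoc (e ∷ p) f = e ∷ snoc p f

    closing : ∀ {x vs y z} → Path x vs y → Adj y z → Linked Adj (x ∷ (vs ∷ʳ z))
    closing []            yz = yz ∷ [-]
    closing ((xy , _) ∷ p) yz = xy ∷ closing p yz

    endpoint : ∀ {x vs y} → Path x vs y → y ∈ x ∷ vs
    endpoint []      = here refl
    endpoint (_ ∷ p) = there (endpoint p)

    Inside : Fin n → Fin n → Fin n → Set
    Inside x y z = z ≡ x ⊎ z ≡ y ⊎ depth z < depth x ⊔ depth y

    -- The deeper of the two ends is replaced by its parent. By `Inside`, every vertex of the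
    -- shorter path other than its ends lies strictly above the deeper end, so the vertex put back
    -- is new and the path has no repetition.
    path : ∀ b x y → depth x + depth y ≤ b →
           ∃[ vs ] Path x vs y × Unique (x ∷ vs) × (∀ {z} → z ∈ x ∷ vs → Inside x y z)
    path b x y ≤b with x Fin.≟ y
    ... | yes refl = [] , [] , [] ∷ [] , λ { (here refl) → inj₁ refl }
    ... | no x≢y with ≤-total (depth y) (depth x)
    path zero    x y ≤b | no x≢y | _ = contradiction (trans (root x (m+n≡0⇒m≡0 (depth x) (n≤0⇒n≡0 ≤b)))
        (sym (root y (m+n≡0⇒n≡0 (depth x) (n≤0⇒n≡0 ≤b))))) x≢y
      where
      root : ∀ z → depth z ≡ 0 → z ≡ r
      root z eq = subst (λ l → Walk l z) eq (proj₁ (proj₂ (shortest z)))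
    path (suc b) x y ≤b | no x≢y | inj₁ y≤x =
      par x ∷ vs , (adj-par x≢r , inj₁ refl) ∷ p , All.tabulate fresh ∷ u , inside′
      where
      x≢r : x ≢ r
      x≢r refl = x≢y (sym (subst (λ l → Walk l y)
        (n≤0⇒n≡0 (≤-trans y≤x (≤-reflexive depth-root))) (proj₁ (proj₂ (shortest y)))))
      rec : ∃[ vs ] Path (par x) vs y × Unique (par x ∷ vs) × (∀ {z} → z ∈ par x ∷ vs → Inside (par x) y z)
      rec = path b (par x) y (≤-pred (≤-trans (≤-reflexive (cong (_+ depth y) (sym (depth-par x≢r)))) ≤b))
      vs = proj₁ rec
      p = proj₁ (proj₂ rec)
      u = proj₁ (proj₂ (proj₂ rec))
      inside = proj₂ (proj₂ (proj₂ rec))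
      par< : depth (par x) < depth x
      par< = ≤-reflexive (sym (depth-par x≢r))
      max≤ : depth (par x) ⊔ depth y ≤ depth x
      max≤ = ⊔-lub (<⇒≤ par<) y≤x
      fresh : ∀ {z} → z ∈ par x ∷ vs → x ≢ z
      fresh z∈ refl with inside z∈
      ... | inj₁ x≡par        = <-irrefl (cong depth (sym x≡par)) par<
      ... | inj₂ (inj₁ x≡y)   = x≢y x≡y
      ... | inj₂ (inj₂ lt)    = <⇒≱ lt max≤
      inside′ : ∀ {z} → z ∈ x ∷ par x ∷ vs → Inside x y z
      inside′ (here refl) = inj₁ refl
      inside′ (there z∈) with inside z∈
      ... | inj₁ refl         = inj₂ (inj₂ (<-≤-trans par< (m≤m⊔n _ _)))
      ... | inj₂ (inj₁ z≡y)   = inj₂ (inj₁ z≡y)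
      ... | inj₂ (inj₂ lt)    = inj₂ (inj₂ (<-≤-trans lt (≤-trans max≤ (m≤m⊔n _ _))))
    path (suc b) x y ≤b | no x≢y | inj₂ x≤y =
      vs ∷ʳ y , snoc p (adj-sym (adj-par y≢r) , inj₂ refl) ,
      Unique.++⁺ u ([] ∷ []) (λ { (z∈ , here refl) → fresh z∈ refl }) , inside′
      where
      y≢r : y ≢ r
      y≢r refl = x≢y (subst (λ l → Walk l x)
        (n≤0⇒n≡0 (≤-trans x≤y (≤-reflexive depth-root))) (proj₁ (proj₂ (shortest x))))
      rec : ∃[ vs ] Path x vs (par y) × Unique (x ∷ vs) × (∀ {z} → z ∈ x ∷ vs → Inside x (par y) z)
      rec = path b x (par y) (≤-pred (≤-trans (≤-reflexive (trans (sym (+-suc (depth x) _))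
              (cong (depth x +_) (sym (depth-par y≢r))))) ≤b))
      vs = proj₁ rec
      p = proj₁ (proj₂ rec)
      u = proj₁ (proj₂ (proj₂ rec))
      inside = proj₂ (proj₂ (proj₂ rec))
      par< : depth (par y) < depth y
      par< = ≤-reflexive (sym (depth-par y≢r))
      max≤ : depth x ⊔ depth (par y) ≤ depth y
      max≤ = ⊔-lub x≤y (<⇒≤ par<)
      fresh : ∀ {z} → z ∈ x ∷ vs → z ≢ y
      fresh z∈ refl with inside z∈
      ... | inj₁ y≡x          = x≢y (sym y≡x)
      ... | inj₂ (inj₁ y≡par) = <-irrefl (cong depth (sym y≡par)) par<
      ... | inj₂ (inj₂ lt)    = <⇒≱ lt max≤
      inside′ : ∀ {z} → z ∈ (x ∷ vs) ++ [ y ] → Inside x y z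
      inside′ z∈ with ∈-++⁻ (x ∷ vs) z∈
      ... | inj₂ (here refl) = inj₂ (inj₁ refl)
      ... | inj₁ z∈′ with inside z∈′
      ... | inj₁ z≡x          = inj₁ z≡x
      ... | inj₂ (inj₁ refl)  = inj₂ (inj₂ (<-≤-trans par< (m≤n⊔m (depth x) _)))
      ... | inj₂ (inj₂ lt)    = inj₂ (inj₂ (<-≤-trans lt (≤-trans max≤ (m≤n⊔m (depth x) _))))

    -- Otherwise the path of parent edges from `x` to `y` has at least two edges, and the edge
    -- between `x` and `y` closes it to a cycle.
    edge : ∀ {x y} → Adj x y → par x ≡ y ⊎ par y ≡ x
    edge {x} {y} xy = decidable-stable ((par x Fin.≟ y) ⊎-dec (par y Fin.≟ x))
      λ ¬parent → let vs , p , u , _ = path _ x y ≤-refl in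
        acyclic (record { v = x ; vs = vs ; long = long ¬parent p ; distinct = u ; closed = closing p (adj-sym xy) })
      where
      long : ∀ {vs} → ¬ (par x ≡ y ⊎ par y ≡ x) → Path x vs y → 2 ≤ length vs
      long _       []                = contradiction xy λ xx → subst T (Graph.irreflexive G x) xx
      long ¬parent ((_ , p) ∷ [])    = contradiction p ¬parent
      long _       (_ ∷ (_ ∷ _))     = s≤s (s≤s z≤n)

  rooting : Rooting G r
  rooting = record
    { par = par ; depth = depth ; depth-root = depth-root ; par-root = par-root
    ; depth-par = depth-par ; adj-par = adj-par ; edge = edge }

T-does : ∀ {P : Set} (P? : Dec P) → T (does P?) → P
T-does (yes p) _ = p

does-T : ∀ {P : Set} (P? : Dec P) → P → T (does P?)
does-T (yes _) _ = _
does-T (no ¬p) p = ¬p p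

record Ranking {n} (par : Fin n → Fin n) (r : Fin n) : Set where
  field
    par-root : par r ≡ r
    rank     : Fin n → ℕ
    rank-par : ∀ {x} → x ≢ r → rank (par x) < rank x

  rank-par≤ : ∀ x → rank (par x) ≤ rank x
  rank-par≤ x with x Fin.≟ r
  ... | yes refl = ≤-reflexive (cong rank par-root)
  ... | no x≢r   = <⇒≤ (rank-par x≢r)

module _ {n : ℕ} (par : Fin n → Fin n) where

  -- The inequality discards the loop at the root, which is its own parent.
  ParentEdge : Fin n → Fin n → Set
  ParentEdge x y = x ≢ y × (par x ≡ y ⊎ par y ≡ x)

  parentEdge? : ∀ x y → Dec (ParentEdge x y)
  parentEdge? x y = ¬? (x Fin.≟ y) ×-dec ((par x Fin.≟ y) ⊎-dec (par y Fin.≟ x))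

  parentEdge-sym : ∀ {x y} → ParentEdge x y → ParentEdge y x
  parentEdge-sym (x≢y , inj₁ p) = x≢y ∘ sym , inj₂ p
  parentEdge-sym (x≢y , inj₂ p) = x≢y ∘ sym , inj₁ p

  parentGraph : Graph n
  parentGraph = record
    { adj         = λ x y → does (parentEdge? x y)
    ; symmetric   = λ x y → does-⇔ (mk⇔ parentEdge-sym parentEdge-sym) (parentEdge? x y) (parentEdge? y x)
    ; irreflexive = λ x → dec-false (parentEdge? x x) λ (x≢x , _) → x≢x refl
    }

  open Graph parentGraph using (Adj)

  module _ {r : Fin n} (R : Ranking par r) where
    open Ranking R

    private
      edge : ∀ {x y} → Adj x y → ParentEdge x y
      edge {x} {y} = T-does (parentEdge? x y)

      up : ∀ {x y} → x ≢ y → par x ≡ y → rank y < rank x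
      up x≢y refl = rank-par λ x≡r → x≢y (trans x≡r (trans (sym par-root) (sym (cong par x≡r))))

      NonBacktracking : List (Fin n) → Set
      NonBacktracking (x ∷ y ∷ z ∷ zs) = x ≢ z × NonBacktracking (y ∷ z ∷ zs)
      NonBacktracking _                = ⊤

      nonBacktracking : ∀ xs {v} → Unique xs → ¬ v ∈ xs → NonBacktracking (xs ∷ʳ v)
      nonBacktracking []               _       _  = _
      nonBacktracking (x ∷ [])         _       _  = _
      nonBacktracking (x ∷ y ∷ [])     _       v∉ = (λ x≡v → v∉ (here (sym x≡v))) , _
      nonBacktracking (x ∷ y ∷ z ∷ zs) ((_ ∷ x≢z ∷ _) ∷ u) v∉ =
        x≢z , nonBacktracking (y ∷ z ∷ zs) u (v∉ ∘ there)

      -- A non-backtracking walk that has once moved away from the root keeps doing so.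

      descend : ∀ x y zs {v} → Linked Adj (x ∷ y ∷ (zs ∷ʳ v)) → NonBacktracking (x ∷ y ∷ (zs ∷ʳ v)) →
                par y ≡ x → rank x < rank v × par v ∈ y ∷ zs
      descend x y []       (xy ∷ yv ∷ _) (x≢v , _) down with edge yv
      ... | _   , inj₁ par-y = contradiction (trans (sym down) par-y) x≢v
      ... | y≢v , inj₂ par-v = <-trans (up (proj₁ (edge xy) ∘ sym) down) (up (y≢v ∘ sym) par-v) , here par-v
      descend x y (z ∷ zs) (xy ∷ walk@(yz ∷ _)) (x≢z , nb) down with edge yz
      ... | _ , inj₁ par-y = contradiction (trans (sym down) par-y) x≢z
      ... | _ , inj₂ par-z = let lt , v∈ = descend y z zs walk nb par-z in
                             <-trans (up (proj₁ (edge xy) ∘ sym) down) lt , there v∈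

      ascend : ∀ x y zs {v} → Linked Adj (x ∷ y ∷ (zs ∷ʳ v)) → NonBacktracking (x ∷ y ∷ (zs ∷ʳ v)) →
               rank v < rank x ⊎ par v ∈ y ∷ zs
      ascend x y zs       walk@(xy ∷ _) nb with edge xy
      ascend x y zs       walk          nb | _ , inj₂ par-y = inj₂ (proj₂ (descend x y zs walk nb par-y))
      ascend x y []       (_ ∷ yv ∷ _)  nb | x≢y , inj₁ par-x with edge yv
      ... | y≢v , inj₁ par-y = inj₁ (<-trans (up y≢v par-y) (up x≢y par-x))
      ... | _   , inj₂ par-v = inj₂ (here par-v)
      ascend x y (z ∷ zs) (_ ∷ walk) (_ , nb) | x≢y , inj₁ par-x with ascend y z zs walk nb
      ... | inj₁ lt = inj₁ (<-trans lt (up x≢y par-x))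
      ... | inj₂ v∈ = inj₂ (there v∈)

      -- If the first step from `v` leads away from the root, then so do all later ones, and the
      -- cycle returns to `v` at a higher rank. If it leads to the parent `a` of `v`, then either
      -- the rest of the cycle also climbs, and the rank falls all the way round, or `v` is entered
      -- from its parent `a`, which is thus visited twice.
      acyclic : ¬ Cycle parentGraph
      acyclic record { v = v ; vs = a ∷ b ∷ zs ; distinct = (v≢a ∷ v∉) ∷ a∉ ∷ u ; closed = va ∷ walk }
        with edge va
      ... | _ , inj₂ par-a = <-irrefl refl (proj₁ (descend v a (b ∷ zs) (va ∷ walk) (All.head v∉ , nb) par-a))
        where
        nb : NonBacktracking (a ∷ b ∷ (zs ∷ʳ v))
        nb = nonBacktracking (a ∷ b ∷ zs) (a∉ ∷ u) λ v∈ → All.lookup (v≢a ∷ v∉) v∈ refl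
      ... | _ , inj₁ par-v with ascend a b zs walk (nonBacktracking (a ∷ b ∷ zs) (a∉ ∷ u) λ v∈ → All.lookup (v≢a ∷ v∉) v∈ refl)
      ... | inj₁ lt = <-asym lt (up v≢a par-v)
      ... | inj₂ v∈ = All.lookup a∉ (subst (_∈ b ∷ zs) par-v v∈) refl
      acyclic record { vs = _ ∷ [] ; long = s≤s () }

      to-root : ∀ x → Acc _<_ (rank x) → Star Adj x r
      to-root x (acc rec) with x Fin.≟ r
      ... | yes refl = ε
      ... | no x≢r   = does-T (parentEdge? x (par x))
                         ((λ x≡ → <-irrefl (cong rank (sym x≡)) (rank-par x≢r)) , inj₁ refl)
                       ◅ to-root (par x) (rec (rank-par x≢r))

    parentTree : Tree n
    parentTree = record
      { graph  = parentGraph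
      ; isTree = record
        { nonEmpty  = Fin.nonZeroIndex r
        ; connected = λ x y → to-root x (<-wellFounded _) ◅◅
            Star.reverse (λ {x} {y} → subst T (Graph.symmetric parentGraph x y)) (to-root y (<-wellFounded _))
        ; acyclic   = acyclic
        }
      }

-- Edges and root determine the parents. The edge from `x` to `p x` goes to an edge; if `f x` were
-- the parent of `f (p x)`, then induction on the rank would give p (p x) = x, although ranks
-- decrease along `p`.
par-equivariant : ∀ {n} {p p′ : Fin n → Fin n} {r r′} → Ranking p r → Ranking p′ r′ →
  (f : Fin n → Fin n) → Injective _≡_ _≡_ f → f r ≡ r′ →
  (∀ {x y} → ParentEdge p x y → ParentEdge p′ (f x) (f y)) → ∀ x → f (p x) ≡ p′ (f x)
par-equivariant {p = p} {p′} {r} {r′} R R′ f inj fr hom x = go x (<-wellFounded _)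
  where
  open Ranking R
  go : ∀ x → Acc _<_ (rank x) → f (p x) ≡ p′ (f x)
  go x (acc rec) with x Fin.≟ r
  ... | yes refl = trans (cong f par-root) (trans fr (trans (sym (Ranking.par-root R′)) (cong p′ (sym fr))))
  ... | no x≢r with proj₂ (hom {x} {p x} ((λ x≡ → <-irrefl (cong rank (sym x≡)) (rank-par x≢r)) , inj₁ refl))
  ... | inj₁ eq = sym eq
  ... | inj₂ eq = contradiction (rank-par x≢r) (≤⇒≯ (≤-trans (≤-reflexive (cong rank (sym back))) (rank-par≤ (p x))))
    where
    back : p (p x) ≡ x
    back = inj (trans (go (p x) (rec (rank-par x≢r))) eq)

-- Surgery at a vertex


-- W = w (suc _) is a set of s vertices closed under descendants, hanging from the
-- root r = w zero; code gives the parents of its vertices, and the z j i are children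
-- of r outside W.

record Site (s m : ℕ) {n : ℕ} (par : Fin n → Fin n) (r : Fin n) : Set where
  field
    3≤s     : 3 ≤ s
    w       : Fin (suc s) → Fin n
    w-inj   : ∀ {i j} → w i ≡ w j → i ≡ j
    w-zero  : w zero ≡ r
    code    : Fin s → Fin (suc s)
    par-w   : ∀ i → par (w (suc i)) ≡ w (code i)
    outside : ∀ {x} → (∀ i → w i ≢ x) → ∀ i → w (suc i) ≢ par x
    z       : Fin 3 → Fin m → Fin n
    z-inj   : ∀ {j i j′ i′} → z j i ≡ z j′ i′ → j ≡ j′ × i ≡ i′
    z∉w     : ∀ {j i} l → w l ≢ z j i
    par-z   : ∀ {j i} → par (z j i) ≡ r

  hub : Fin 3 → Fin s
  hub j = inject≤ j 3≤s

-- The tree is rearranged by turning W into the path w 0 , w 1 , … , w s and moving,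
-- for each j, the first κ j of the children z j _ of the root below the hub w (suc j).

module Surgery {s m n : ℕ} {par : Fin n → Fin n} {r : Fin n} (R : Ranking par r)
               (A : Site s m par r) (κ : Fin 3 → Fin m) where
  open Ranking R
  open Site A public

  Moved : Fin 3 → Fin n → Set
  Moved j x = ∃[ i ] toℕ i < toℕ (κ j) × z j i ≡ x

  private
    chain? : ∀ x → Dec (∃[ i ] w (suc i) ≡ x)
    chain? x = any? (λ i → w (suc i) Fin.≟ x)

    moved? : ∀ x → Dec (∃[ j ] Moved j x)
    moved? x = any? (λ j → any? (λ i → (toℕ i <? toℕ (κ j)) ×-dec (z j i Fin.≟ x)))

    move : ∀ x → Dec (∃[ i ] w (suc i) ≡ x) → Dec (∃[ j ] Moved j x) → Fin n
    move x (yes (i , _)) _             = w (inject₁ i)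
    move x (no _)        (yes (j , _)) = w (suc (hub j))
    move x (no _)        (no _)        = par x

    climb : ∀ x → Dec (∃[ i ] w i ≡ x) → ℕ
    climb x (yes (i , _)) = toℕ i
    climb x (no _)        = suc s + rank x

  par′ : Fin n → Fin n
  par′ x = move x (chain? x) (moved? x)

  par′-w : ∀ i → par′ (w (suc i)) ≡ w (inject₁ i)
  par′-w i with chain? (w (suc i))
  ... | yes (i′ , eq) = cong (w ∘ inject₁) (Fin.suc-injective (w-inj eq))
  ... | no ∄          = contradiction (i , refl) ∄

  par′-moved : ∀ {j x} → Moved j x → par′ x ≡ w (suc (hub j))
  par′-moved {j} {x} (i , lt , refl) with chain? x | moved? x
  ... | yes (l , p) | _ = contradiction p (z∉w (suc l))
  ... | no _ | yes (j′ , i′ , _ , p) = cong (w ∘ suc ∘ hub) (proj₁ (z-inj p))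
  ... | no _ | no ∄ = contradiction (j , i , lt , refl) ∄

  -- Off the path the new tree alone tells the two cases apart: the new parent belongs to W exactly
  -- if the vertex was moved, and then the old parent was the root.
  data Step (x : Fin n) : Set where
    moved : ∀ j → Moved j x → par′ x ≡ w (suc (hub j)) → par x ≡ r → Step x
    kept  : par′ x ≡ par x → (∀ i → w (suc i) ≢ par′ x) → Step x

  step : ∀ x → (∀ i → w i ≢ x) → Step x
  step x x∉ with chain? x in eq | moved? x in eq′
  ... | yes (i , p) | _  = contradiction p (x∉ (suc i))
  ... | no ∄ | yes (j , i , lt , refl) = moved j (i , lt , refl) (cong₂ (move x) eq eq′) par-z
  ... | no ∄ | no ∄′     = kept par′≡ (λ i p → outside x∉ i (trans p par′≡))
    where
    par′≡ : par′ x ≡ par x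
    par′≡ = cong₂ (move x) eq eq′

  par′-root : par′ r ≡ r
  par′-root with chain? r | moved? r
  ... | yes (i , p) | _ = contradiction (w-inj (trans p (sym w-zero))) λ ()
  ... | no _ | yes (j , i , _ , p) = contradiction (trans w-zero (sym p)) (z∉w zero)
  ... | no _ | no _ = par-root

  private
    -- Vertices of the path are ranked by their position, all others by s + 1 plus the old rank.
    -- This exceeds every position, so it drops for moved vertices as well as for kept ones.
    rank′ : Fin n → ℕ
    rank′ x = climb x (any? (λ i → w i Fin.≟ x))

    rank′-w : ∀ i → rank′ (w i) ≡ toℕ i
    rank′-w i with any? (λ j → w j Fin.≟ w i)
    ... | yes (j , eq) = cong toℕ (w-inj eq)
    ... | no ∄         = contradiction (i , refl) ∄

    rank′-decreases : ∀ {x} → x ≢ r → rank′ (par′ x) < rank′ x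
    rank′-decreases {x} x≢r with any? (λ i → w i Fin.≟ x)
    ... | yes (zero  , refl) = contradiction w-zero x≢r
    ... | yes (suc i , refl) = s≤s (≤-reflexive (trans (cong rank′ (par′-w i))
                                 (trans (rank′-w (inject₁ i)) (toℕ-inject₁ i))))
    ... | no ∄ with step x (λ i p → ∄ (i , p))
    ... | moved j _ eq _ = s≤s (≤-trans (≤-reflexive (trans (cong rank′ eq) (rank′-w (suc (hub j)))))
                                (≤-trans (toℕ<n (hub j)) (m≤m+n s (rank x))))
    ... | kept eq _ with any? (λ i → w i Fin.≟ par′ x)
    ... | yes (i , _) = s≤s (≤-trans (≤-pred (toℕ<n i)) (m≤m+n s (rank x)))
    ... | no _        = s≤s (+-monoʳ-< s (subst (λ y → rank y < rank x) (sym eq) (rank-par x≢r)))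

  ranking′ : Ranking par′ r
  ranking′ = record { par-root = par′-root ; rank = rank′ ; rank-par = rank′-decreases }

-- The rearranged tree, its root, the end of the path and code determine everything.

module Recovery {s m n : ℕ} {p₁ p₂ : Fin n → Fin n} {r₁ r₂ : Fin n}
                (R₁ : Ranking p₁ r₁) (A₁ : Site s m p₁ r₁) (κ₁ : Fin 3 → Fin m)
                (R₂ : Ranking p₂ r₂) (A₂ : Site s m p₂ r₂) (κ₂ : Fin 3 → Fin m) where

  private
    module A = Surgery R₁ A₁ κ₁
    module B = Surgery R₂ A₂ κ₂

  module _ (f : Fin n → Fin n) (f-inj : Injective _≡_ _≡_ f) (f-root : f r₁ ≡ r₂)
           (f-tip : f (A.w (fromℕ s)) ≡ B.w (fromℕ s))
           (code≡ : ∀ i → A.code i ≡ B.code i)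
           (hom : ∀ {x y} → ParentEdge A.par′ x y → ParentEdge B.par′ (f x) (f y)) where

    private
      f-par′ : ∀ x → f (A.par′ x) ≡ B.par′ (f x)
      f-par′ = par-equivariant A.ranking′ B.ranking′ f f-inj f-root hom

      -- In the new tree each vertex of the path has its predecessor as parent, so agreement at the
      -- end of the path spreads back to the root.
      f-w : ∀ i → f (A.w i) ≡ B.w i
      f-w = >-weakInduction (λ i → f (A.w i) ≡ B.w i) f-tip λ i eq →
        trans (cong f (sym (A.par′-w i))) (trans (f-par′ _) (trans (cong B.par′ eq) (B.par′-w i)))

      f-outside : ∀ {x} → (∀ i → A.w i ≢ x) → ∀ i → B.w i ≢ f x
      f-outside x∉ i p = x∉ i (f-inj (trans (f-w i) p))

    -- On the path the old parents are read off from `code`. Elsewhere the parent is unchanged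
    -- unless it is now a vertex of W, in which case it used to be the root.
    f-par : ∀ x → f (p₁ x) ≡ p₂ (f x)
    f-par x with any? (λ i → A.w i Fin.≟ x)
    ... | yes (zero , refl) = trans (cong (f ∘ p₁) A.w-zero) (trans (cong f (Ranking.par-root R₁)) (trans f-root
            (trans (sym (Ranking.par-root R₂)) (cong p₂ (sym (trans (cong f A.w-zero) f-root))))))
    ... | yes (suc i , refl) = trans (cong f (A.par-w i)) (trans (f-w (A.code i))
            (trans (cong B.w (code≡ i)) (trans (sym (B.par-w i)) (cong p₂ (sym (f-w (suc i)))))))
    ... | no ∄ with A.step x (λ i p → ∄ (i , p)) | B.step (f x) (f-outside λ i p → ∄ (i , p))
    ... | A.moved _ _ _ px | B.moved _ _ _ pfx = trans (cong f px) (trans f-root (sym pfx))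
    ... | A.moved j _ eq _ | B.kept _ fx∉ = contradiction
            (trans (sym (f-w (suc (A.hub j)))) (trans (cong f (sym eq)) (f-par′ x))) (fx∉ (A.hub j))
    ... | A.kept _ x∉ | B.moved j _ eq _ = contradiction
            (f-inj (trans (f-w (suc (B.hub j))) (trans (sym eq) (sym (f-par′ x))))) (x∉ (B.hub j))
    ... | A.kept eq _ | B.kept eq′ _ = trans (cong f (sym eq)) (trans (f-par′ x) eq′)

    -- The vertices moved below the hub of `j` are sent injectively to children, off the path, of
    -- the corresponding hub in the second tree. There only moved vertices of block `j` have that
    -- parent. The reverse inequality comes from the inverse map.
    κ-mono : ∀ j → toℕ (κ₁ j) ≤ toℕ (κ₂ j)
    κ-mono j = injective⇒≤ {f = target} target-inj
      where
      source : Fin (toℕ (κ₁ j)) → Fin m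
      source i = inject≤ i (<⇒≤ (toℕ<n (κ₁ j)))
      par-image : ∀ i → f (A.w (suc (A.hub j))) ≡ B.par′ (f (A.z j (source i)))
      par-image i = trans (cong f (sym (A.par′-moved (source i , below i , refl)))) (f-par′ _)
        where
        below : ∀ i → toℕ (source i) < toℕ (κ₁ j)
        below i = ≤-trans (s≤s (≤-reflexive (toℕ-inject≤ i _))) (toℕ<n i)
      image : ∀ i → B.Moved j (f (A.z j (source i)))
      image i with B.step (f (A.z j (source i))) (f-outside λ l → A.z∉w l)
      ... | B.kept _ fx∉      = contradiction (trans (sym (f-w (suc (A.hub j)))) (par-image i)) (fx∉ (A.hub j))
      ... | B.moved j′ mv eq _ = subst (λ j → B.Moved j _) (inject≤-injective _ _ j′ j
              (Fin.suc-injective (B.w-inj (trans (sym eq) (trans (sym (par-image i)) (f-w (suc (A.hub j)))))))) mv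
      target : Fin (toℕ (κ₁ j)) → Fin (toℕ (κ₂ j))
      target i = fromℕ< (proj₁ (proj₂ (image i)))
      target-inj : Injective _≡_ _≡_ target
      target-inj {i} {i′} eq = inject≤-injective _ _ i i′ (proj₂ (A.z-inj (f-inj
        (trans (sym (proj₂ (proj₂ (image i)))) (trans (cong (B.z j) (toℕ-injective (fromℕ<-injective _ _ _ _ eq)))
          (proj₂ (proj₂ (image i′))))))))

-- Small branches at a vertex of high degree

length-filter≡∑ : ∀ {P : X → Set} (P? : Decidable P) xs →
                  length (filter P? xs) ≡ ∑ xs (λ x → if does (P? x) then 1 else 0)
length-filter≡∑ P? []       = refl
length-filter≡∑ P? (x ∷ xs) with P? x
... | yes _ = cong suc (length-filter≡∑ P? xs)
... | no  _ = length-filter≡∑ P? xs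

lookup-injective : ∀ {xs : List X} → Unique xs → ∀ i j → lookup xs i ≡ lookup xs j → i ≡ j
lookup-injective (_ ∷ u)  zero    zero    _  = refl
lookup-injective (p ∷ _)  zero    (suc j) eq = contradiction eq (All.lookup p (∈-lookup j))
lookup-injective (p ∷ _)  (suc i) zero    eq = contradiction (sym eq) (All.lookup p (∈-lookup i))
lookup-injective (_ ∷ u)  (suc i) (suc j) eq = cong suc (lookup-injective u i j eq)

unique-⊆-length : ∀ {xs ys : List X} → Unique xs → (∀ {x} → x ∈ xs → x ∈ ys) → length xs ≤ length ys
unique-⊆-length {xs = xs} {ys} u xs⊆ys = injective⇒≤ {f = λ i → index (xs⊆ys (∈-lookup i))} λ {i} {j} eq →
  lookup-injective u i j (trans (lookup-index (xs⊆ys (∈-lookup i)))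
    (trans (cong (lookup ys) eq) (sym (lookup-index (xs⊆ys (∈-lookup j))))))

-- Here `c` and `b` count the branches with at most 24 and at least 25 vertices. If c ≤ 2, then 25 b
-- ≤ n < 24 + 12 b forces b ≤ 1, and so n < 36.
three-small : ∀ c b n → 36 ≤ n → n < (c + b) * 12 → b * 25 ≤ n → 3 ≤ c
three-small c b n 36≤n n< b≤ with 3 ≤? c
... | yes 3≤c = 3≤c
... | no 3≰c  = contradiction 36≤n (<⇒≱ (<-≤-trans n<′ (*-monoˡ-≤ 12 (+-monoʳ-≤ 2 b≤1))))
  where
  open ≤-Reasoning
  n<′ : n < (2 + b) * 12
  n<′ = <-≤-trans n< (*-monoˡ-≤ 12 (+-monoˡ-≤ b (≤-pred (≰⇒> 3≰c))))
  split : ∀ b → b * 25 ≡ b * 13 + b * 12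
  split = solve-∀
  b≤1 : b ≤ 1
  b≤1 = ≤-pred (*-cancelʳ-< 13 b 2 (<-trans (+-cancelʳ-< (b * 12) _ _ (begin-strict
    b * 13 + b * 12 ≡⟨ split b ⟨
    b * 25          ≤⟨ b≤ ⟩
    n               <⟨ n<′ ⟩
    (2 + b) * 12    ≡⟨ *-distribʳ-+ 12 2 b ⟩
    24 + b * 12     ∎)) (m≤m+n 25 1)))

-- From 48 m ≤ n < 12 (3 + l) follows 4 m ≤ 2 + l. Three of the four multiples of `m` are wanted;
-- the fourth, being at least 2, makes up for the three children that are spent on W.
enough-children : ∀ l m n → 2 ≤ m → m * 48 ≤ n → n < (3 + l) * 12 → 3 * m ≤ l
enough-children l m n 2≤m m≤ n< = +-cancelˡ-≤ 2 _ _ (begin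
  2 + 3 * m   ≤⟨ +-monoˡ-≤ (3 * m) 2≤m ⟩
  4 * m       ≡⟨ *-comm 4 m ⟩
  m * 4       ≤⟨ ≤-pred (*-cancelʳ-< 12 (m * 4) (3 + l) (≤-<-trans (≤-trans (≤-reflexive (*-assoc m 4 12)) m≤) n<)) ⟩
  2 + l       ∎)
  where open ≤-Reasoning

module _ {n : ℕ} (G : Graph n) (r : Fin n) (R : Rooting G r) where
  open Rooting R
  open Graph G using (Adj; adj)

  rooting⇒ranking : Ranking par r
  rooting⇒ranking = record
    { par-root = par-root ; rank = depth ; rank-par = λ x≢r → ≤-reflexive (sym (depth-par x≢r)) }

  private
    climb : ℕ → Fin n → Fin n
    climb zero    x = x
    climb (suc l) x = climb l (par x)

    -- The ancestor of depth 1, which names the branch containing `x`; the root gets itself.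
    branch : Fin n → Fin n
    branch x = climb (depth x ∸ 1) x

    branch-child : ∀ {x} → x ≢ r → par x ≡ r → branch x ≡ x
    branch-child {x} x≢r eq = cong (λ d → climb (d ∸ 1) x)
      (trans (depth-par x≢r) (cong suc (trans (cong depth eq) depth-root)))

    branch-par : ∀ {x} → x ≢ r → par x ≢ r → branch x ≡ branch (par x)
    branch-par {x} x≢r p≢r =
      trans (cong (λ d → climb (d ∸ 1) x) (trans (depth-par x≢r) (cong suc (depth-par p≢r))))
            (cong (λ d → climb (d ∸ 1) (par x)) (sym (depth-par p≢r)))

    child? : Decidable (λ x → Adj r x)
    child? x = T? (adj r x)

    children : List (Fin n)
    children = filter child? (allFin n)

    children-unique : Unique children
    children-unique = filter⁺ child? (allFin⁺ n)

    child-spec : ∀ {c} → c ∈ children → c ≢ r × par c ≡ r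
    child-spec {c} c∈ with proj₂ (∈-filter⁻ child? {xs = allFin n} c∈)
    ... | rc = c≢r , par-c (edge rc)
      where
      c≢r : c ≢ r
      c≢r refl = subst T (Graph.irreflexive G c) rc
      par-c : par r ≡ c ⊎ par c ≡ r → par c ≡ r
      par-c (inj₁ eq) = contradiction (trans (sym eq) par-root) c≢r
      par-c (inj₂ eq) = eq

    length-children : length children ≡ degree G r
    length-children = trans (length-filter≡∑ child? (allFin n)) (∑-cong (allFin n) λ {x} _ → does≡ x)
      where
      does≡ : ∀ x → (if does (child? x) then 1 else 0) ≡ indicator G r x
      does≡ x with adj r x
      ... | true  = refl
      ... | false = refl

    size : Fin n → ℕ
    size u = ∑ (allFin n) (λ x → if does (branch x Fin.≟ u) then 1 else 0)

    ∑-size : ∀ {us} → Unique us → ∑ us size ≤ n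
    ∑-size {us} u = begin
      ∑ us size                                                                  ≡⟨ ∑-swap us (allFin n) _ ⟩
      ∑ (allFin n) (λ x → ∑ us (λ u → if does (branch x Fin.≟ u) then 1 else 0)) ≤⟨ ∑-mono (allFin n) (λ {x} _ → ∑-δ (branch x) 1 us u) ⟩
      ∑ (allFin n) (λ _ → 1)                                                     ≡⟨ ∑-1 (allFin n) ⟩
      length (allFin n)                                                          ≡⟨ length-tabulate (λ x → x) ⟩
      n                                                                          ∎
      where open ≤-Reasoning

    small? : Decidable (λ u → size u ≤ 24)
    small? u = size u ≤? 24

    big-count : length (filter (∁? small?) children) * 25 ≤ n
    big-count = begin
      length big * 25            ≡⟨ ∑-const big 25 ⟨
      ∑ big (λ _ → 25)           ≤⟨ ∑-mono big (λ u∈ → ≰⇒> (proj₂ (∈-filter⁻ (∁? small?) {xs = children} u∈))) ⟩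
      ∑ big size                 ≤⟨ ∑-size (filter⁺ (∁? small?) children-unique) ⟩
      n                          ∎
      where
      open ≤-Reasoning
      big = filter (∁? small?) children

  -- Branches are disjoint, so at most n/25 of them have 25 vertices or more, and by `three-small`
  -- three small ones exist. Their union W has at most 3 · 24 = 72 vertices, and the remaining
  -- children of the root are numerous enough for three blocks of length `m`.
  site : ∀ m → 2 ≤ m → 36 ≤ n → m * 48 ≤ n → n < degree G r * 12 → ∃[ s ] s ≤ 72 × Site s m par r
  site m 2≤m 36≤n m≤ n< with filter small? children in eq
  ... | us = go us eq (three-small (length us) (length big) n 36≤n (≤-trans n< (≤-reflexive (cong (_* 12) deg))) big-count)
    where
    big : List (Fin n)
    big = filter (∁? small?) children
    deg : degree G r ≡ length us + length big
    deg = trans (sym length-children) (trans (↭-length (↭-filter small? children))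
            (trans (length-++ (filter small? children)) (cong (λ l → length l + length big) eq)))
    go : ∀ us → filter small? children ≡ us → 3 ≤ length us → ∃[ s ] s ≤ 72 × Site s m par r
    go (_ ∷ [])           _  (s≤s ())
    go (_ ∷ _ ∷ [])       _  (s≤s (s≤s ()))
    go (u₁ ∷ u₂ ∷ u₃ ∷ us) eq _ = length W , W-small , record
      { 3≤s     = unique-⊆-length U-unique U⊆W
      ; w       = lookup (r ∷ W)
      ; w-inj   = λ {i} {j} → lookup-injective (All.tabulate (λ x∈ r≡x → proj₁ (W-spec x∈) (sym r≡x)) ∷ filter⁺ W? (allFin⁺ n)) i j
      ; w-zero  = refl
      ; code    = λ i → index (W-closed (∈-lookup i))
      ; par-w   = λ i → lookup-index (W-closed (∈-lookup i))
      ; outside = λ x∉ i p → outside x∉ (subst (_∈ W) p (∈-lookup i))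
      ; z       = λ j i → lookup Z (inject≤ (combine j i) enoughZ)
      ; z-inj   = λ {j} {i} {j′} {i′} p → Fin.combine-injective j i j′ i′
                    (inject≤-injective _ _ _ _ (lookup-injective (unique-++ʳ U U++Z-unique) _ _ p))
      ; z∉w     = λ l p → Z∉ l (subst (_∈ Z) (sym p) (∈-lookup _))
      ; par-z   = proj₂ (child-spec (Z⊆ (∈-lookup _)))
      }
      where
      open ≤-Reasoning
      U Z W : List (Fin n)
      U = u₁ ∷ u₂ ∷ u₃ ∷ []
      Z = us ++ big
      W? : Decidable (λ x → x ≢ r × branch x ∈ U)
      W? x = ¬? (x Fin.≟ r) ×-dec _∈?_ Fin._≟_ (branch x) U
      W = filter W? (allFin n)
      perm : children ↭ U ++ Z
      perm = subst (λ us → children ↭ us ++ big) eq (↭-filter small? children)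
      U++Z-unique : Unique (U ++ Z)
      U++Z-unique = unique-↭ perm children-unique
      U-unique : Unique U
      U-unique = unique-++ˡ U U++Z-unique
        where
        unique-++ˡ : ∀ (xs : List (Fin n)) {ys} → Unique (xs ++ ys) → Unique xs
        unique-++ˡ []       _       = []
        unique-++ˡ (x ∷ xs) (p ∷ u) = All.++⁻ˡ xs p ∷ unique-++ˡ xs u
      U⊆ : ∀ {u} → u ∈ U → u ∈ children
      U⊆ u∈ = ∈-resp-↭ (↭-sym perm) (∈-++⁺ˡ u∈)
      Z⊆ : ∀ {u} → u ∈ Z → u ∈ children
      Z⊆ u∈ = ∈-resp-↭ (↭-sym perm) (∈-++⁺ʳ U u∈)
      W-spec : ∀ {x} → x ∈ W → x ≢ r × branch x ∈ U
      W-spec x∈ = proj₂ (∈-filter⁻ W? {xs = allFin n} x∈)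
      in-W : ∀ {x} → x ≢ r → branch x ∈ U → x ∈ W
      in-W x≢r b∈ = ∈-filter⁺ W? (∈-allFin _) (x≢r , b∈)
      U⊆W : ∀ {u} → u ∈ U → u ∈ W
      U⊆W u∈ = let u≢r , pu = child-spec (U⊆ u∈) in
               in-W u≢r (subst (_∈ U) (sym (branch-child u≢r pu)) u∈)
      W-closed : ∀ {x} → x ∈ W → par x ∈ r ∷ W
      W-closed {x} x∈ with par x Fin.≟ r
      ... | yes p≡r = here p≡r
      ... | no p≢r  = let x≢r , b∈ = W-spec x∈ in there (in-W p≢r (subst (_∈ U) (branch-par x≢r p≢r) b∈))
      outside : ∀ {x} → (∀ i → lookup (r ∷ W) i ≢ x) → ¬ par x ∈ W
      outside {x} x∉ px∈ = let p≢r , b∈ = W-spec px∈ in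
        let x∈W = in-W x≢r (subst (_∈ U) (sym (branch-par x≢r p≢r)) b∈) in
        x∉ (suc (index x∈W)) (sym (lookup-index x∈W))
        where
        x≢r : x ≢ r
        x≢r x≡r = x∉ zero (sym x≡r)
      Z∉ : ∀ l → ¬ lookup (r ∷ W) l ∈ Z
      Z∉ zero    z∈ = proj₁ (child-spec (Z⊆ z∈)) refl
      Z∉ (suc l) z∈ = let z≢r , pz = child-spec (Z⊆ z∈) in
        unique-disjoint U U++Z-unique (subst (_∈ U) (branch-child z≢r pz) (proj₂ (W-spec (∈-lookup l)))) z∈
      enoughZ : 3 * m ≤ length Z
      enoughZ = enough-children (length Z) m n 2≤m m≤ (≤-trans n< (≤-reflexive
        (cong (_* 12) (trans (sym length-children) (↭-length perm)))))
      U-small : ∑ U size ≤ 72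
      U-small = ∑-mono U {g = λ _ → 24} λ u∈ → proj₂ (∈-filter⁻ small? {xs = children}
        (subst (_ ∈_) (sym eq) (∈-++⁺ˡ u∈)))
      W-small : length W ≤ 72
      W-small = begin
        length W                                                                   ≤⟨ length-filter≤∑ W? counted (allFin n) ⟩
        ∑ (allFin n) (λ x → ∑ U (λ u → if does (branch x Fin.≟ u) then 1 else 0)) ≡⟨ ∑-swap U (allFin n) (λ u x → if does (branch x Fin.≟ u) then 1 else 0) ⟨
        ∑ U size                                                                   ≤⟨ U-small ⟩
        72                                                                         ∎
        where
        counted : ∀ {x} → x ≢ r × branch x ∈ U → 1 ≤ ∑ U (λ u → if does (branch x Fin.≟ u) then 1 else 0)
        counted {x} (_ , b∈) = ≤-trans (≤-reflexive (sym hit)) (≤-∑ (λ u → if does (branch x Fin.≟ u) then 1 else 0) b∈)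
          where
          hit : (if does (branch x Fin.≟ branch x) then 1 else 0) ≡ 1
          hit with branch x Fin.≟ branch x
          ... | yes _ = refl
          ... | no ≢  = contradiction refl ≢

-- Enumerations of setoids


record Enumeration (S : Setoid 0ℓ 0ℓ) (m : ℕ) : Set where
  open Setoid S using (Carrier; _≈_)
  field
    rep      : Fin m → Carrier
    distinct : ∀ {i j} → rep i ≈ rep j → i ≡ j
    covers   : ∀ a → ∃[ i ] a ≈ rep i

enumeration⇒cardinality : ∀ {S m} → Enumeration S m → HasCardinality S m
enumeration⇒cardinality {S} E = record
  { to        = λ a → proj₁ (covers a)
  ; from      = rep
  ; to-cong   = λ {a} {b} a≈b → distinct (S.trans (S.sym (proj₂ (covers a))) (S.trans a≈b (proj₂ (covers b))))
  ; from-cong = λ { refl → S.refl }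
  ; inverse   = (λ {x} {y} y≈ → distinct (S.trans (S.sym (proj₂ (covers y))) y≈)) ,
                (λ { {x} refl → S.sym (proj₂ (covers x)) })
  }
  where
  open Enumeration E
  module S = Setoid S

module _ (S : Setoid 0ℓ 0ℓ) (_≈?_ : Binary.Decidable (Setoid._≈_ S)) where
  open Setoid S using (Carrier; _≈_)

  private
    module S = Setoid S

    deduplicated : (xs : List Carrier) → ∃[ ys ] AllPairs (λ a b → ¬ a ≈ b) ys × (∀ {x} → x ∈ xs → Any (x ≈_) ys)
    deduplicated []       = [] , [] , λ ()
    deduplicated (x ∷ xs) with deduplicated xs
    ... | ys , apart , cov with Any.any? (x ≈?_) ys
    ... | yes x∈ = ys , apart , λ { (here refl) → x∈ ; (there y∈) → cov y∈ }
    ... | no x∉  = x ∷ ys , All.¬Any⇒All¬ ys x∉ ∷ apart , λ { (here refl) → here S.refl ; (there y∈) → there (cov y∈) }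

    lookup-apart : ∀ {ys} → AllPairs (λ a b → ¬ a ≈ b) ys → ∀ {i j} → lookup ys i ≈ lookup ys j → i ≡ j
    lookup-apart (_ ∷ _)  {zero}  {zero}  _  = refl
    lookup-apart (p ∷ _)  {zero}  {suc j} eq = contradiction eq (All.lookup p (∈-lookup j))
    lookup-apart (p ∷ _)  {suc i} {zero}  eq = contradiction (S.sym eq) (All.lookup p (∈-lookup i))
    lookup-apart (_ ∷ ap) {suc i} {suc j} eq = cong suc (lookup-apart ap eq)

  enumerate : (xs : List Carrier) → (∀ a → Any (a ≈_) xs) → ∃[ m ] Enumeration S m
  enumerate xs complete with deduplicated xs
  ... | ys , apart , cov = length ys , record
    { rep      = lookup ys
    ; distinct = lookup-apart apart
    ; covers   = covers
    }
    where
    covers : ∀ a → ∃[ i ] a ≈ lookup ys i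
    covers a = let a∈ = complete a ; x∈ = cov (∈-lookup {xs = xs} (index a∈)) in
               index x∈ , S.trans (lookup-index a∈) (lookup-index x∈)

module Split {S : Setoid 0ℓ 0ℓ} {m : ℕ} (E : Enumeration S m) {P : Setoid.Carrier S → Set}
             (P? : Decidable P) (resp : ∀ {a b} → Setoid._≈_ S a b → P a → P b) where
  open Enumeration E

  goods bads : List (Fin m)
  goods = filter (P? ∘ rep) (allFin m)
  bads  = filter (∁? (P? ∘ rep)) (allFin m)

  goods+bads : length goods + length bads ≡ m
  goods+bads = trans (sym (length-++ goods)) (trans (sym (↭-length (↭-filter (P? ∘ rep) (allFin m))))
                 (length-tabulate (λ x → x)))

  bad : ∀ i → ¬ P (rep (lookup bads i))
  bad i = proj₂ (∈-filter⁻ (∁? (P? ∘ rep)) {xs = allFin m} (∈-lookup i))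

  bads-injective : ∀ {i j} → lookup bads i ≡ lookup bads j → i ≡ j
  bads-injective {i} {j} = lookup-injective (filter⁺ (∁? (P? ∘ rep)) (allFin⁺ m)) i j

  enumerate-goods : Enumeration (subsetoid S P) (length goods)
  enumerate-goods = record
    { rep      = λ i → rep (lookup goods i) , proj₂ (∈-filter⁻ (P? ∘ rep) {xs = allFin m} (∈-lookup i))
    ; distinct = λ {i} {j} eq → lookup-injective (filter⁺ (P? ∘ rep) (allFin⁺ m)) i j (distinct eq)
    ; covers   = λ (a , p) → let i , a≈ = covers a in
                 let i∈ = ∈-filter⁺ (P? ∘ rep) (∈-allFin i) (resp a≈ p) in
                 index i∈ , Setoid.trans S a≈ (Setoid.reflexive S (cong rep (lookup-index i∈)))
    }

-- A finite list of all trees, and decidability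

concatMap-allFin⁺ : ∀ {A : Set} {P : A → Set} {N} (f : Fin N → List A) i → Any P (f i) → Any P (concatMap f (allFin N))
concatMap-allFin⁺ f i p = Any.concat⁺ (Any.map⁺ (lose (∈-allFin i) p))

module _ {n : ℕ} where

  -- Counting the vertices of smaller rank preserves strict inequalities and gives values below `n`,
  -- so that only finitely many rankings have to be tried.
  compress : ∀ {par : Fin n → Fin n} {r} → Ranking par r → ∃[ rank ] ∀ {x} → x ≢ r → toℕ {n} (rank (par x)) < toℕ (rank x)
  compress {par} {r} R = (λ x → fromℕ< (bounded x)) , λ {x} x≢r →
    subst (_< toℕ (fromℕ< (bounded x))) (sym (toℕ-fromℕ< (bounded (par x))))
      (subst (below (par x) <_) (sym (toℕ-fromℕ< (bounded x))) (monotone (rank-par x≢r)))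
    where
    open Ranking R
    Below? : ∀ x → Decidable (λ y → rank y < rank x)
    Below? x y = rank y <? rank x
    below : Fin n → ℕ
    below x = length (filter (Below? x) (allFin n))
    bounded : ∀ x → below x < n
    bounded x = <-≤-trans (filter-notAll (Below? x) (allFin n) (lose (∈-allFin x) (<-irrefl refl)))
                          (≤-reflexive (length-tabulate (λ x → x)))
    monotone : ∀ {x y} → rank x < rank y → below x < below y
    monotone {x} {y} x<y = unique-⊆-length
      (All.tabulate (λ z∈ x≡z → <-irrefl (cong rank (sym x≡z)) (proj₂ (∈-filter⁻ (Below? x) {xs = allFin n} z∈)))
        ∷ filter⁺ (Below? x) (allFin⁺ n))
      λ { (here refl) → ∈-filter⁺ (Below? y) (∈-allFin _) x<y
        ; (there z∈)  → ∈-filter⁺ (Below? y) (∈-allFin _)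
                          (<-trans (proj₂ (∈-filter⁻ (Below? x) {xs = allFin n} z∈)) x<y) }

  private
    Ranks : Fin n → (Fin n → Fin n) → (Fin n → Fin n) → Set
    Ranks r par rank = par r ≡ r × (∀ x → x ≢ r → toℕ (rank (par x)) < toℕ (rank x))

    ranks? : ∀ r par rank → Dec (Ranks r par rank)
    ranks? r par rank = (par r Fin.≟ r) ×-dec all? (λ x → ¬? (x Fin.≟ r) →-dec (toℕ (rank (par x)) <? toℕ (rank x)))

    candidate : ∀ r par rank → Dec (Ranks r par rank) → List (Tree n)
    candidate r par rank (yes (root , dec)) =
      [ parentTree par {r} (record { par-root = root ; rank = toℕ ∘ rank ; rank-par = λ {x} → dec x }) ]
    candidate r par rank (no _) = []

  -- Listing a root, a parent function and a rank avoids deciding whether a given graph is a tree. A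
  -- tree occurs many times; `enumerate` removes the repetitions.
  candidates : List (Tree n)
  candidates = concatMap (λ r → concatMap (λ p → concatMap (λ k →
    candidate r (finToFun p) (finToFun k) (ranks? r (finToFun p) (finToFun k)))
    (allFin (n ^ n))) (allFin (n ^ n))) (allFin n)

  bool-≡ : ∀ {b c} → (T b → T c) → (T c → T b) → b ≡ c
  bool-≡ {b} {c} to from = does-⇔ (mk⇔ to from) (T? b) (T? c)

  rooting-edge : ∀ {G : Graph n} {r} (R : Rooting G r) x y →
                 Graph.adj G x y ≡ does (parentEdge? (Rooting.par R) x y)
  rooting-edge {G} {r} R x y = bool-≡ to from
    where
    open Rooting R
    open Graph G using (Adj)
    to : Adj x y → T (does (parentEdge? par x y))
    to xy = does-T (parentEdge? par x y) ((λ x≡y → subst T (Graph.irreflexive G x) (subst (Adj x) (sym x≡y) xy)) , edge xy)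
    up : ∀ {x y} → x ≢ y → par x ≡ y → Adj x y
    up x≢y refl = adj-par λ x≡r → x≢y (trans x≡r (trans (sym par-root) (cong par (sym x≡r))))
    from : T (does (parentEdge? par x y)) → Adj x y
    from xy with T-does (parentEdge? par x y) xy
    ... | x≢y , inj₁ p = up x≢y p
    ... | x≢y , inj₂ p = subst T (Graph.symmetric G y x) (up (x≢y ∘ sym) p)

  parentEdge-cong : ∀ {p q : Fin n → Fin n} → (∀ x → p x ≡ q x) → ∀ {x y} → ParentEdge p x y → ParentEdge q x y
  parentEdge-cong p≗q {x} {y} (x≢y , inj₁ eq) = x≢y , inj₁ (trans (sym (p≗q x)) eq)
  parentEdge-cong p≗q {x} {y} (x≢y , inj₂ eq) = x≢y , inj₂ (trans (sym (p≗q y)) eq)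

  candidates-complete : ∀ (t : Tree n) → Any (Setoid._≈_ (labeledTrees n) t) candidates
  candidates-complete t =
    concatMap-allFin⁺ _ r (concatMap-allFin⁺ _ (funToFin par) (concatMap-allFin⁺ _ (funToFin rank) found))
    where
    open Tree t
    r : Fin n
    r = root n (IsTree.nonEmpty isTree)
      where
      root : ∀ n → NonZero n → Fin n
      root (suc n) _ = zero
    R : Rooting graph r
    R = rooting graph isTree r
    open Rooting R using (par; par-root)
    ranked : ∃[ rank ] ∀ {x} → x ≢ r → toℕ {n} (rank (par x)) < toℕ (rank x)
    ranked = compress (rooting⇒ranking graph r R)
    rank : Fin n → Fin n
    rank = proj₁ ranked
    par′ rank′ : Fin n → Fin n
    par′ = finToFun (funToFin par)
    rank′ = finToFun (funToFin rank)
    par≗ : ∀ x → par′ x ≡ par x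
    par≗ = finToFun-funToFin par
    ranks : Ranks r par′ rank′
    ranks = trans (par≗ r) par-root , λ x x≢r → subst₂ (λ a b → toℕ a < toℕ b)
      (sym (trans (finToFun-funToFin rank (par′ x)) (cong rank (par≗ x))))
      (sym (finToFun-funToFin rank x)) (proj₂ ranked x≢r)
    found : Any (Setoid._≈_ (labeledTrees n) t) (candidate r par′ rank′ (ranks? r par′ rank′))
    found with ranks? r par′ rank′
    ... | no ¬p = contradiction ranks ¬p
    ... | yes _ = here λ u v → trans (rooting-edge R u v)
      (does-⇔ (mk⇔ (parentEdge-cong (sym ∘ par≗)) (parentEdge-cong par≗)) (parentEdge? par u v) (parentEdge? par′ u v))

  graph≈? : ∀ (G H : Graph n) → Dec (∀ u v → Graph.adj G u v ≡ Graph.adj H u v)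
  graph≈? G H = all? (λ u → all? (λ v → Graph.adj G u v Bool.≟ Graph.adj H u v))

  _≅?_ : ∀ (G H : Graph n) → Dec (G ≅ H)
  G ≅? H = map′ to from (any? λ i → any? λ j → isomorphism? (finToFun i) (finToFun j))
    where
    Isomorphism : (f g : Fin n → Fin n) → Set
    Isomorphism f g = (∀ x → f (g x) ≡ x) × (∀ x → g (f x) ≡ x) ×
                      (∀ u v → Graph.adj G u v ≡ Graph.adj H (f u) (f v))
    isomorphism? : ∀ f g → Dec (Isomorphism f g)
    isomorphism? f g = all? (λ x → f (g x) Fin.≟ x) ×-dec all? (λ x → g (f x) Fin.≟ x) ×-dec
                       all? (λ u → all? (λ v → Graph.adj G u v Bool.≟ Graph.adj H (f u) (f v)))
    to : (∃[ i ] ∃[ j ] Isomorphism (finToFun i) (finToFun j)) → G ≅ H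
    to (i , j , fg , gf , hom) = permutation (finToFun i) (finToFun j) fg gf , hom
    from : G ≅ H → ∃[ i ] ∃[ j ] Isomorphism (finToFun i) (finToFun j)
    from (π , hom) = funToFin f , funToFin g ,
      (λ x → trans (f≗ _) (trans (cong f (g≗ x)) (inverseʳ π))) ,
      (λ x → trans (g≗ _) (trans (cong g (f≗ x)) (inverseˡ π))) ,
      (λ u v → trans (hom u v) (sym (cong₂ (Graph.adj H) (f≗ u) (f≗ v))))
      where
      f g : Fin n → Fin n
      f = π ⟨$⟩ʳ_
      g = π ⟨$⟩ˡ_
      f≗ : ∀ x → finToFun (funToFin f) x ≡ f x
      f≗ = finToFun-funToFin f
      g≗ : ∀ x → finToFun (funToFin g) x ≡ g x
      g≗ = finToFun-funToFin g

  classSize-≤ : ∀ {k} {c c′ : Fin n → Fin k} (f : Fin n → Fin n) → Injective _≡_ _≡_ f →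
                (∀ v → c′ (f v) ≡ c v) → ∀ i → classSize c i ≤ classSize c′ i
  classSize-≤ {c = c} {c′} f f-inj eq i = subst (_≤ classSize c′ i) (length-map f (filter (λ v → c v Fin.≟ i) (allFin n)))
    (unique-⊆-length (Unique.map⁺ f-inj (filter⁺ (λ v → c v Fin.≟ i) (allFin⁺ n)))
      λ x∈ → let v , v∈ , x≡ = ∈-map⁻ f x∈ in
        ∈-filter⁺ (λ v → c′ v Fin.≟ i) (∈-allFin _)
          (trans (cong c′ x≡) (trans (eq v) (proj₂ (∈-filter⁻ (λ v → c v Fin.≟ i) {xs = allFin n} v∈)))))

  balanced-≅ : ∀ {k} {G H : Graph n} → G ≅ H → StronglyBalanced k G → StronglyBalanced k H
  balanced-≅ {G = G} {H} (π , hom) B = record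
    { colour   = colour′
    ; proper   = λ u v uv → proper _ _ (subst T (trans
        (cong₂ (Graph.adj H) (sym (inverseʳ π)) (sym (inverseʳ π))) (sym (hom (π ⟨$⟩ˡ u) (π ⟨$⟩ˡ v)))) uv)
    ; balanced = λ i j i≢j → subst₂ (λ a b → ∣ a - b ∣ ≤ 1) (size i) (size j) (balanced i j i≢j)
    }
    where
    open StronglyBalanced B
    colour′ = λ v → colour (π ⟨$⟩ˡ v)
    size : ∀ i → classSize colour i ≡ classSize colour′ i
    size i = ≤-antisym
      (classSize-≤ (π ⟨$⟩ʳ_) (λ eq → trans (sym (inverseˡ π)) (trans (cong (π ⟨$⟩ˡ_) eq) (inverseˡ π)))
        (λ v → cong colour (inverseˡ π)) i)
      (classSize-≤ (π ⟨$⟩ˡ_) (λ eq → trans (sym (inverseʳ π)) (trans (cong (π ⟨$⟩ʳ_) eq) (inverseʳ π)))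
        (λ v → refl) i)

  balanced? : ∀ k (G : Graph n) → Dec (StronglyBalanced k G)
  balanced? k G = map′
    (λ (i , proper , balanced) → record { colour = finToFun i ; proper = proper ; balanced = balanced })
    (λ B → let open StronglyBalanced B in funToFin colour ,
      (λ u v uv eq → proper u v uv (trans (sym (finToFun-funToFin colour u)) (trans eq (finToFun-funToFin colour v)))) ,
      (λ i j i≢j → subst₂ (λ a b → ∣ a - b ∣ ≤ 1) (size colour i) (size colour j) (balanced i j i≢j)))
    (any? λ i → all? (λ u → all? λ v → T? (Graph.adj G u v) →-dec ¬? (finToFun i u Fin.≟ finToFun i v)) ×-dec
                all? (λ a → all? λ b → ¬? (a Fin.≟ b) →-dec
                  (∣ classSize (finToFun {k} {n} i) a - classSize (finToFun {k} {n} i) b ∣ ≤? 1)))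
    where
    size : ∀ (c : Fin n → Fin k) i → classSize c i ≡ classSize (finToFun {k} {n} (funToFin c)) i
    size c i = cong length (filter-cong-∈ (λ v → c v Fin.≟ i) (λ v → finToFun (funToFin c) v Fin.≟ i) (allFin n)
      (λ {v} _ eq → trans (finToFun-funToFin c v) eq) (λ {v} _ eq → trans (sym (finToFun-funToFin c v)) eq))

-- Counting

-- The permutations realising _≈_: only the identity for labelled trees, all of
-- them for unlabelled ones.

record Realisation {n : ℕ} (_≈_ : Tree n → Tree n → Set) : Set₁ where
  field
    Allowed : Permutation′ n → Set
    comp    : ∀ {π ρ} → Allowed π → Allowed ρ → Allowed (π ∘ₚ ρ)
    inv     : ∀ {π} → Allowed π → Allowed (flipₚ π)

  Via : Graph n → Graph n → Permutation′ n → Set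
  Via G H π = ∀ u v → Graph.adj G u v ≡ Graph.adj H (π ⟨$⟩ʳ u) (π ⟨$⟩ʳ v)

  field
    unpack : ∀ {t t′} → t ≈ t′ → ∃[ π ] Allowed π × Via (Tree.graph t) (Tree.graph t′) π
    pack   : ∀ {t t′ π} → Allowed π → Via (Tree.graph t) (Tree.graph t′) π → t ≈ t′

permutation-injective : ∀ {n} (π : Permutation′ n) → Injective _≡_ _≡_ (π ⟨$⟩ʳ_)
permutation-injective π eq = trans (sym (inverseˡ π)) (trans (cong (π ⟨$⟩ˡ_) eq) (inverseˡ π))

combine₅-injective : ∀ {k l m n o} {a a′ : Fin k} {b b′ : Fin l} {c c′ : Fin m} {d d′ : Fin n} {e e′ : Fin o} →
  combine a (combine b (combine c (combine d e))) ≡ combine a′ (combine b′ (combine c′ (combine d′ e′))) →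
  a ≡ a′ × b ≡ b′ × c ≡ c′ × d ≡ d′ × e ≡ e′
combine₅-injective {a = a} {a′} {b} {b′} {c} {c′} {d} {d′} {e} {e′} eq =
  let a≡ , eq₁ = combine-injective a _ a′ _ eq
      b≡ , eq₂ = combine-injective b _ b′ _ eq₁
      c≡ , eq₃ = combine-injective c _ c′ _ eq₂
      d≡ , e≡  = combine-injective d e d′ e′ eq₃
  in a≡ , b≡ , c≡ , d≡ , e≡

×-injective⇒≤ : ∀ {k l m} (f : Fin k × Fin l → Fin m) → (∀ x y → f x ≡ f y → x ≡ y) → k * l ≤ m
×-injective⇒≤ {k} {l} f f-inj = injective⇒≤ {f = f ∘ remQuot l} λ {x} {y} eq →
  trans (sym (combine-remQuot {k} l x))
    (trans (cong (λ (i , j) → combine i j) (f-inj (remQuot {k} l x) (remQuot {k} l y) eq)) (combine-remQuot {k} l y))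

-- For every s ≤ S this is at least the number of possible codes on `s` vertices, so that one set of
-- labels serves all sites.
code-space : ℕ → ℕ
code-space S = suc S ^ S

encode : ∀ {s S} → s ≤ S → (Fin s → Fin (suc s)) → Fin (code-space S)
encode {s} {S} s≤S f = inject≤ (funToFin f) (≤-trans (^-monoˡ-≤ s (s≤s s≤S)) (^-monoʳ-≤ (suc S) s≤S))

encode-injective : ∀ {s S} (p q : s ≤ S) f g → encode p f ≡ encode q g → ∀ i → f i ≡ g i
encode-injective p q f g eq i = trans (sym (finToFun-funToFin f i))
  (trans (cong (λ k → finToFun k i) (inject≤-injective _ _ (funToFin f) (funToFin g) eq)) (finToFun-funToFin g i))

-- `κ-mono` is applied to `π` and to its inverse, which turns its inequalities into equalities.
recover : ∀ {n m S s₁ s₂} {p₁ p₂ : Fin n → Fin n} {r₁ r₂}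
  (R₁ : Ranking p₁ r₁) (R₂ : Ranking p₂ r₂) (s₁≤ : s₁ ≤ S) (s₂≤ : s₂ ≤ S)
  (A₁ : Site s₁ m p₁ r₁) (A₂ : Site s₂ m p₂ r₂) (κ₁ κ₂ : Fin 3 → Fin m) (π : Permutation′ n) →
  (∀ u v → does (parentEdge? (Surgery.par′ R₁ A₁ κ₁) u v) ≡
           does (parentEdge? (Surgery.par′ R₂ A₂ κ₂) (π ⟨$⟩ʳ u) (π ⟨$⟩ʳ v))) →
  π ⟨$⟩ʳ r₁ ≡ r₂ → s₁ ≡ s₂ → π ⟨$⟩ʳ Site.w A₁ (fromℕ s₁) ≡ Site.w A₂ (fromℕ s₂) →
  encode s₁≤ (Site.code A₁) ≡ encode s₂≤ (Site.code A₂) →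
  (∀ x → π ⟨$⟩ʳ p₁ x ≡ p₂ (π ⟨$⟩ʳ x)) × (∀ j → κ₁ j ≡ κ₂ j)
recover {p₁ = p₁} {p₂} {r₁} {r₂} R₁ R₂ s₁≤ s₂≤ A₁ A₂ κ₁ κ₂ π hom root refl tip code =
  Recovery.f-par R₁ A₁ κ₁ R₂ A₂ κ₂ (π ⟨$⟩ʳ_) (permutation-injective π) root tip code≡ hom₁ ,
  λ j → toℕ-injective (≤-antisym
    (Recovery.κ-mono R₁ A₁ κ₁ R₂ A₂ κ₂ (π ⟨$⟩ʳ_) (permutation-injective π) root tip code≡ hom₁ j)
    (Recovery.κ-mono R₂ A₂ κ₂ R₁ A₁ κ₁ (π ⟨$⟩ˡ_) (permutation-injective (flipₚ π))
      (trans (cong (π ⟨$⟩ˡ_) (sym root)) (inverseˡ π)) (trans (cong (π ⟨$⟩ˡ_) (sym tip)) (inverseˡ π))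
      (sym ∘ code≡) hom₂ j))
  where
  E₁ = parentEdge? (Surgery.par′ R₁ A₁ κ₁)
  E₂ = parentEdge? (Surgery.par′ R₂ A₂ κ₂)
  code≡ : ∀ i → Site.code A₁ i ≡ Site.code A₂ i
  code≡ = encode-injective s₁≤ s₂≤ (Site.code A₁) (Site.code A₂) code
  hom₁ : ∀ {x y} → ParentEdge (Surgery.par′ R₁ A₁ κ₁) x y → ParentEdge (Surgery.par′ R₂ A₂ κ₂) (π ⟨$⟩ʳ x) (π ⟨$⟩ʳ y)
  hom₁ {x} {y} xy = T-does (E₂ _ _) (subst T (hom x y) (does-T (E₁ x y) xy))
  hom₂ : ∀ {x y} → ParentEdge (Surgery.par′ R₂ A₂ κ₂) x y → ParentEdge (Surgery.par′ R₁ A₁ κ₁) (π ⟨$⟩ˡ x) (π ⟨$⟩ˡ y)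
  hom₂ {x} {y} xy = T-does (E₁ _ _) (subst T (sym (hom _ _))
    (does-T (E₂ _ _) (subst₂ (ParentEdge (Surgery.par′ R₂ A₂ κ₂)) (sym (inverseʳ π)) (sym (inverseʳ π)) xy)))

module _ {n : ℕ} {_≈_ : Tree n → Tree n → Set} (I : Realisation _≈_)
         {total : ℕ} (rep : Fin total → Tree n)
         (distinct : ∀ {i j} → rep i ≈ rep j → i ≡ j) (covers : ∀ t → ∃[ i ] t ≈ rep i)
         {b : ℕ} (bad : Fin b → Fin total) (bad-injective : ∀ {i j} → bad i ≡ bad j → i ≡ j)
         (S m : ℕ) (root : Fin b → Fin n) where
  open Realisation I

  private
    tree : Fin b → Tree n
    tree i = rep (bad i)

    rooted : ∀ i → Rooting (Tree.graph (tree i)) (root i)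
    rooted i = rooting (Tree.graph (tree i)) (Tree.isTree (tree i)) (root i)

    par : ∀ i → Fin n → Fin n
    par i = Rooting.par (rooted i)

    ranked : ∀ i → Ranking (par i) (root i)
    ranked i = rooting⇒ranking (Tree.graph (tree i)) (root i) (rooted i)

  module _ (sites : ∀ i → ∃[ s ] s ≤ S × Site s m (par i) (root i)) where

    private
      s : Fin b → ℕ
      s i = proj₁ (sites i)

      s≤S : ∀ i → s i ≤ S
      s≤S i = proj₁ (proj₂ (sites i))

      A : ∀ i → Site (s i) m (par i) (root i)
      A i = proj₂ (proj₂ (sites i))

      image : Fin b → (Fin 3 → Fin m) → Tree n
      image i κ = parentTree (Surgery.par′ (ranked i) (A i) κ) (Surgery.ranking′ (ranked i) (A i) κ)

      Choice : Set
      Choice = Fin b × Fin (m ^ 3)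

      target : Choice → Fin total
      target (i , k) = proj₁ (covers (image i (finToFun k)))

      σ : Choice → Permutation′ n
      σ (i , k) = proj₁ (unpack (proj₂ (covers (image i (finToFun k)))))

      σ-allowed : ∀ x → Allowed (σ x)
      σ-allowed (i , k) = proj₁ (proj₂ (unpack (proj₂ (covers (image i (finToFun k))))))

      σ-via : ∀ x → Via (Tree.graph (image (proj₁ x) (finToFun (proj₂ x)))) (Tree.graph (rep (target x))) (σ x)
      σ-via (i , k) = proj₂ (proj₂ (unpack (proj₂ (covers (image i (finToFun k))))))

      tip : Fin b → Fin n
      tip i = Site.w (A i) (fromℕ (s i))

      -- Only the representative of the class of the new tree can be read off from `target x`, so
      -- root and tip are recorded by their positions there, under the chosen isomorphism `σ x`.
      label : Choice → Fin (total * (n * (n * (suc S * code-space S))))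
      label x@(i , _) = combine (target x) (combine (σ x ⟨$⟩ʳ root i) (combine (σ x ⟨$⟩ʳ tip i)
                          (combine (fromℕ< (s≤s (s≤S i))) (encode (s≤S i) (Site.code (A i))))))

      funToFin-cong : ∀ {l} {f g : Fin l → Fin m} → (∀ j → f j ≡ g j) → funToFin f ≡ funToFin g
      funToFin-cong {zero}  eq = refl
      funToFin-cong {suc l} eq = cong₂ combine (eq zero) (funToFin-cong (eq ∘ suc))

      label-injective : ∀ x y → label x ≡ label y → x ≡ y
      label-injective x@(i , k) y@(j , l) eq = cong₂ _,_ i≡j k≡l
        where
        parts : target x ≡ target y × σ x ⟨$⟩ʳ root i ≡ σ y ⟨$⟩ʳ root j × σ x ⟨$⟩ʳ tip i ≡ σ y ⟨$⟩ʳ tip j ×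
                fromℕ< (s≤s (s≤S i)) ≡ fromℕ< (s≤s (s≤S j)) ×
                encode (s≤S i) (Site.code (A i)) ≡ encode (s≤S j) (Site.code (A j))
        parts = combine₅-injective eq
        t≡ = proj₁ parts
        r≡ = proj₁ (proj₂ parts)
        w≡ = proj₁ (proj₂ (proj₂ parts))
        s≡ = proj₁ (proj₂ (proj₂ (proj₂ parts)))
        code≡ = proj₂ (proj₂ (proj₂ (proj₂ parts)))
        -- Both new trees are carried to the same representative, so going there and back is an
        -- isomorphism between them. The recorded positions agree, hence it matches roots and tips.
        π : Permutation′ n
        π = σ x ∘ₚ flipₚ (σ y)
        via : Via (Tree.graph (image i (finToFun k))) (Tree.graph (image j (finToFun l))) π
        via u v = trans (σ-via x u v) (trans (cong (λ t → Graph.adj (Tree.graph (rep t)) (σ x ⟨$⟩ʳ u) (σ x ⟨$⟩ʳ v)) t≡)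
          (trans (sym (cong₂ (Graph.adj (Tree.graph (rep (target y)))) (inverseʳ (σ y)) (inverseʳ (σ y))))
                 (sym (σ-via y _ _))))
        recovered : (∀ x → π ⟨$⟩ʳ par i x ≡ par j (π ⟨$⟩ʳ x)) × (∀ c → finToFun k c ≡ finToFun l c)
        recovered = recover (ranked i) (ranked j) (s≤S i) (s≤S j) (A i) (A j) (finToFun k) (finToFun l) π via
          (trans (cong (σ y ⟨$⟩ˡ_) r≡) (inverseˡ (σ y))) (fromℕ<-injective _ _ _ _ s≡)
          (trans (cong (σ y ⟨$⟩ˡ_) w≡) (inverseˡ (σ y))) code≡
        k≡l : k ≡ l
        k≡l = trans (sym (Fin.funToFin-finToFin {3} {m} k)) (trans (funToFin-cong (proj₂ recovered)) (Fin.funToFin-finToFin {3} {m} l))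
        tree-via : Via (Tree.graph (tree i)) (Tree.graph (tree j)) π
        tree-via u v = trans (rooting-edge (rooted i) u v)
          (trans (does-⇔ (mk⇔ to from) (parentEdge? (par i) u v) (parentEdge? (par j) (π ⟨$⟩ʳ u) (π ⟨$⟩ʳ v)))
                 (sym (rooting-edge (rooted j) _ _)))
          where
          πpar : ∀ x → π ⟨$⟩ʳ par i x ≡ par j (π ⟨$⟩ʳ x)
          πpar = proj₁ recovered
          inj : Injective _≡_ _≡_ (π ⟨$⟩ʳ_)
          inj = permutation-injective π
          to : ParentEdge (par i) u v → ParentEdge (par j) (π ⟨$⟩ʳ u) (π ⟨$⟩ʳ v)
          to (u≢v , inj₁ p) = u≢v ∘ inj , inj₁ (trans (sym (πpar u)) (cong (π ⟨$⟩ʳ_) p))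
          to (u≢v , inj₂ p) = u≢v ∘ inj , inj₂ (trans (sym (πpar v)) (cong (π ⟨$⟩ʳ_) p))
          from : ParentEdge (par j) (π ⟨$⟩ʳ u) (π ⟨$⟩ʳ v) → ParentEdge (par i) u v
          from (u≢v , inj₁ p) = u≢v ∘ cong (π ⟨$⟩ʳ_) , inj₁ (inj (trans (πpar u) p))
          from (u≢v , inj₂ p) = u≢v ∘ cong (π ⟨$⟩ʳ_) , inj₂ (inj (trans (πpar v) p))
        i≡j : i ≡ j
        i≡j = bad-injective (distinct (pack (comp (σ-allowed x) (inv (σ-allowed y))) tree-via))

    surgery-count : b * m ^ 3 ≤ total * (n * (n * (suc S * code-space S)))
    surgery-count = ×-injective⇒≤ label label-injective

-- Passage to the limit

ratio-close : ∀ a c b .{{_ : NonZero b}} → a + c ≡ b → ∀ q → ℚ.0ℚ ℚ.< q →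
              c * suc (ℚ.ℚ.denominatorℕ q) ≤ b → ℚ.∣ (pos a ℚ./ b) ℚ.- ℚ.1ℚ ∣ ℚ.< q
ratio-close a c b@(suc b-1) a+c≡b q@(ℚ.mkℚ (pos zero) _ _)  (ℚ.*<* lt) _ = contradiction lt λ { (ℤ.+<+ ()) }
ratio-close a c b@(suc b-1) a+c≡b q@(ℚ.mkℚ ℤ.-[1+ _ ] _ _) (ℚ.*<* ())
ratio-close a c b@(suc b-1) a+c≡b q@(ℚ.mkℚ (pos (suc num)) den-1 _) _ c≤ = ℚ.toℚᵘ-cancel-< (begin-strict
  ℚ.toℚᵘ ℚ.∣ (pos a ℚ./ b) ℚ.- ℚ.1ℚ ∣            ≃⟨ ℚ.toℚᵘ-homo-∣-∣ ((pos a ℚ./ b) ℚ.- ℚ.1ℚ) ⟩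
  ℚᵘ.∣ ℚ.toℚᵘ ((pos a ℚ./ b) ℚ.- ℚ.1ℚ) ∣         ≃⟨ ℚᵘ.∣-∣-cong (ℚ.toℚᵘ-homo-+ (pos a ℚ./ b) (ℚ.- ℚ.1ℚ)) ⟩
  ℚᵘ.∣ ℚ.toℚᵘ (pos a ℚ./ b) ℚᵘ.- ℚᵘ.1ℚᵘ ∣        ≃⟨ ℚᵘ.∣-∣-cong (ℚᵘ.+-congˡ (ℚᵘ.- ℚᵘ.1ℚᵘ) (ℚ.toℚᵘ-fromℚᵘ (ℚᵘ.mkℚᵘ (pos a) b-1))) ⟩
  ℚᵘ.∣ ℚᵘ.mkℚᵘ (pos a) b-1 ℚᵘ.- ℚᵘ.1ℚᵘ ∣         ≃⟨ ℚᵘ.∣-∣-cong difference ⟩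
  ℚᵘ.∣ ℚᵘ.- ℚᵘ.mkℚᵘ (pos c) b-1 ∣                ≃⟨ ℚᵘ.≃-reflexive (ℚᵘ.∣-p∣≡∣p∣ (ℚᵘ.mkℚᵘ (pos c) b-1)) ⟩
  ℚᵘ.mkℚᵘ (pos c) b-1                            <⟨ ℚᵘ.*<* (subst₂ ℤ._<_ (ℤ.pos-* c (suc den-1)) (ℤ.pos-* (suc num) b) (ℤ.+<+ small)) ⟩
  ℚ.toℚᵘ q                                      ∎)
  where
  open ℚᵘ.≤-Reasoning
  identity : ∀ a c → (a ℤ.* pos 1 ℤ.+ ℤ.- pos 1 ℤ.* (a ℤ.+ c)) ℤ.* (a ℤ.+ c) ≡ ℤ.- c ℤ.* ((a ℤ.+ c) ℤ.* pos 1)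
  identity = ℤ.solve-∀
  difference : ℚᵘ.mkℚᵘ (pos a) b-1 ℚᵘ.- ℚᵘ.1ℚᵘ ℚᵘ.≃ ℚᵘ.- ℚᵘ.mkℚᵘ (pos c) b-1
  difference = ℚᵘ.*≡* (subst (λ b → (pos a ℤ.* pos 1 ℤ.+ ℤ.- pos 1 ℤ.* b) ℤ.* b ≡ ℤ.- pos c ℤ.* (b ℤ.* pos 1))
    (trans (sym (ℤ.pos-+ a c)) (cong pos a+c≡b)) (identity (pos a) (pos c)))
  -- If d is the denominator of `q`, then c/b ≤ 1/(d + 1) < 1/d ≤ q; the 1 added to the denominator
  -- makes the inequality strict.
  small : c * suc den-1 < suc num * b
  small = small′ c c≤
    where
    small′ : ∀ c → c * suc (suc den-1) ≤ b → c * suc den-1 < suc num * b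
    small′ zero    _  = s≤s z≤n
    small′ (suc c) le = <-≤-trans (*-monoʳ-< (suc c) (n<1+n (suc den-1))) (≤-trans le (m≤m+n b (num * b)))

-- With D = d² c, replacing `n` by m d gives b m³ ≤ t m² D, that is b m ≤ t D. Since M D ≤ m, a
-- factor D cancels.
power-bound : ∀ b t n d m c M .{{_ : NonZero d}} .{{_ : NonZero c}} → 1 ≤ m →
  b * m ^ 3 ≤ t * (n * (n * c)) → n ≤ m * d → M * (d * (d * c)) ≤ m → b * M ≤ t
power-bound b t n d m@(suc _) c M _ count n≤ M≤ = *-cancelʳ-≤ (b * M) t D {{m*n≢0 d (d * c) {{it}} {{m*n≢0 d c}}}} (begin
  b * M * D        ≡⟨ *-assoc b M D ⟩
  b * (M * D)      ≤⟨ *-monoʳ-≤ b M≤ ⟩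
  b * m            ≤⟨ *-cancelʳ-≤ (b * m) (t * D) (m * m) (begin
    b * m * (m * m)                  ≡⟨ id₁ b m ⟩
    b * m ^ 3                        ≤⟨ count ⟩
    t * (n * (n * c))                ≤⟨ *-monoʳ-≤ t (*-mono-≤ n≤ (*-monoˡ-≤ c n≤)) ⟩
    t * (m * d * (m * d * c))        ≡⟨ id₂ t m d c ⟩
    t * D * (m * m)                  ∎) ⟩
  t * D            ∎)
  where
  open ≤-Reasoning
  D : ℕ
  D = d * (d * c)
  id₁ : ∀ b m → b * m * (m * m) ≡ b * (m * (m * (m * 1)))
  id₁ = solve-∀
  id₂ : ∀ t m d c → t * (m * d * (m * d * c)) ≡ t * (d * (d * c)) * (m * m)
  id₂ = solve-∀

-- Shows that trees exist on every positive number of vertices, so that the denominators of the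
-- proportions are not zero.
star : ∀ n → Tree (suc n)
star n = parentTree (λ _ → zero) {zero} (record
  { par-root = refl
  ; rank     = λ { zero → 0 ; (suc _) → 1 }
  ; rank-par = λ { {zero} 0≢0 → contradiction refl 0≢0 ; {suc _} _ → s≤s z≤n }
  })

high-degree : ∀ {n} k (t : Tree n) → 3 ≤ k → 36 ≤ n → ¬ StronglyBalanced k (Tree.graph t) →
              ∃[ v ] n < degree (Tree.graph t) v * 12
high-degree {suc n} k t 3≤k 36≤n ¬balanced with any? (λ v → suc n <? degree (Tree.graph t) v * 12)
... | yes found = found
... | no ∄ = contradiction
  (bounded⇒balanced k graph (rooting graph isTree zero) (IsTree.connected isTree) (λ v → ≮⇒≥ λ lt → ∄ (v , lt)) 3≤k 36≤n)
  ¬balanced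
  where open Tree t

-- Labelled and unlabelled trees are treated at once. `coarser` lets the same list of candidates
-- exhaust both, and `finer` makes being balanced a property of the classes.
module _ (_≈_ : ∀ {n} → Tree n → Tree n → Set)
         (isEq : ∀ n → IsEquivalence (_≈_ {n})) (_≈?_ : ∀ {n} (t t′ : Tree n) → Dec (t ≈ t′))
         (realise : ∀ n → Realisation (_≈_ {n}))
         (coarser : ∀ {n} {t t′ : Tree n} → Setoid._≈_ (labeledTrees n) t t′ → t ≈ t′)
         (finer : ∀ {n} {t t′ : Tree n} → t ≈ t′ → Tree.graph t ≅ Tree.graph t′)
         (k : ℕ) (3≤k : 3 ≤ k) where

  private
    trees : ℕ → Setoid 0ℓ 0ℓ
    trees n = record { Carrier = Tree n ; _≈_ = _≈_ ; isEquivalence = isEq n }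

    enumerated : ∀ n → ∃[ m ] Enumeration (trees n) m
    enumerated n = enumerate (trees n) _≈?_ candidates (λ t → Any.map (coarser {t = t}) (candidates-complete t))

    Balanced : ∀ {n} → Tree n → Set
    Balanced t = StronglyBalanced k (Tree.graph t)

    total : ℕ → ℕ
    total n = proj₁ (enumerated n)

    module Counted n = Split (proj₂ (enumerated n)) {Balanced} (λ t → balanced? k (Tree.graph t))
                             (λ t≈t′ → balanced-≅ (finer t≈t′))

    good bad : ℕ → ℕ
    good n = length (Counted.goods n)
    bad n  = length (Counted.bads n)

    -- S is a variable so that code-space 72 is never evaluated.

    few-bad : ∀ S → 72 ≤ S → ∀ M n → 96 ≤ n → M * (96 * (96 * (suc S * code-space S))) * 48 ≤ n → bad n * M ≤ total n
    few-bad S 72≤S M n 96≤n M≤ = power-bound (bad n) (total n) n 96 m (suc S * code-space S) M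
      {{_}} {{m*n≢0 (suc S) (code-space S) {{_}} {{m^n≢0 (suc S) S}}}} (≤-trans (s≤s z≤n) 2≤m)
      (surgery-count (realise n) (Enumeration.rep (proj₂ (enumerated n))) (Enumeration.distinct (proj₂ (enumerated n)))
        (Enumeration.covers (proj₂ (enumerated n))) (lookup (Counted.bads n)) (Counted.bads-injective n) S m
        (λ i → proj₁ (high i)) sites)
      n≤ (≤-trans (≤-reflexive (sym (m*n/n≡m _ 48))) (/-monoˡ-≤ 48 M≤))
      where
      -- 48 = 4 · 12 is the factor required by `enough-children`. From n ≥ 96 follows m ≥ 2, and
      -- then n < 48 (m + 1) ≤ 96 m.
      m : ℕ
      m = n / 48
      2≤m : 2 ≤ m
      2≤m = /-monoˡ-≤ 48 96≤n
      36≤n : 36 ≤ n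
      36≤n = ≤-trans (m≤m+n 36 60) 96≤n
      tree : Fin (bad n) → Tree n
      tree i = Enumeration.rep (proj₂ (enumerated n)) (lookup (Counted.bads n) i)
      high : ∀ i → ∃[ v ] n < degree (Tree.graph (tree i)) v * 12
      high i = high-degree k (tree i) 3≤k 36≤n (Counted.bad n i)
      rooted : ∀ i → Rooting (Tree.graph (tree i)) (proj₁ (high i))
      rooted i = rooting (Tree.graph (tree i)) (Tree.isTree (tree i)) (proj₁ (high i))
      sites : ∀ i → ∃[ s ] s ≤ S × Site s m (Rooting.par (rooted i)) (proj₁ (high i))
      sites i = let s , s≤ , A = site (Tree.graph (tree i)) (proj₁ (high i)) (rooted i) m 2≤m 36≤n (m/n*n≤m n 48) (proj₂ (high i)) in s , ≤-trans s≤ 72≤S , A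
      n≤ : n ≤ m * 96
      n≤ = begin
        n                 ≡⟨ m≡m%n+[m/n]*n n 48 ⟩
        n % 48 + m * 48   ≤⟨ +-monoˡ-≤ (m * 48) (<⇒≤ (m%n<n n 48)) ⟩
        1 * 48 + m * 48   ≤⟨ +-monoˡ-≤ (m * 48) (*-monoˡ-≤ 48 (≤-trans (s≤s z≤n) 2≤m)) ⟩
        m * 48 + m * 48   ≡⟨ *-distribˡ-+ m 48 48 ⟨
        m * 96            ∎
        where open ≤-Reasoning

  almostAll-balanced : AlmostAll trees (λ _ → Balanced)
  almostAll-balanced = good , total ,
    (λ n → enumeration⇒cardinality (Counted.enumerate-goods n)) ,
    (λ n → enumeration⇒cardinality (proj₂ (enumerated n))) ,
    limit 72 ≤-refl
    where
    limit : ∀ S → 72 ≤ S → RatioTendsToOne good total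
    limit S 72≤S q 0<q = 96 + N , λ n N≤n → inhabited n (≤-trans (m≤m+n 96 N) N≤n) ,
      ratio-close (good n) (bad n) (total n) {{inhabited n (≤-trans (m≤m+n 96 N) N≤n)}} (Counted.goods+bads n) q 0<q
        (few-bad S 72≤S M n (≤-trans (m≤m+n 96 N) N≤n) (≤-trans (m≤n+m N 96) N≤n))
      where
      M N : ℕ
      M = suc (ℚ.ℚ.denominatorℕ q)
      N = M * (96 * (96 * (suc S * code-space S))) * 48
      inhabited : ∀ n → 96 ≤ n → NonZero (total n)
      inhabited (suc n) _ = Fin.nonZeroIndex (proj₁ (Enumeration.covers (proj₂ (enumerated (suc n))) (star n)))

theoremB : ∀ (k : ℕ) → 3 ≤ k →
    AlmostAll labeledTrees (λ n t → StronglyBalanced k (Tree.graph t)) ×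
    AlmostAll unlabeledTrees (λ n t → StronglyBalanced k (Tree.graph t))
theoremB k 3≤k =
  almostAll-balanced (λ {n} → Setoid._≈_ (labeledTrees n)) (λ n → Setoid.isEquivalence (labeledTrees n))
    (λ t t′ → graph≈? (Tree.graph t) (Tree.graph t′)) labelled (λ t≈t′ → t≈t′) (λ t≈t′ → idₚ , t≈t′) k 3≤k ,
  almostAll-balanced (λ {n} → Setoid._≈_ (unlabeledTrees n)) (λ n → Setoid.isEquivalence (unlabeledTrees n))
    (λ t t′ → Tree.graph t ≅? Tree.graph t′) unlabelled (λ t≈t′ → idₚ , t≈t′) (λ t≅t′ → t≅t′) k 3≤k
  where
  labelled : ∀ n → Realisation (Setoid._≈_ (labeledTrees n))
  labelled n = record
    -- Being the identity is stated pointwise, because equality of permutations would also compare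
    -- their proof fields.
    { Allowed = λ π → ∀ x → π ⟨$⟩ʳ x ≡ x
    ; comp    = λ {π} {ρ} p q x → trans (cong (ρ ⟨$⟩ʳ_) (p x)) (q x)
    ; inv     = λ {π} p x → trans (cong (π ⟨$⟩ˡ_) (sym (p x))) (inverseˡ π)
    ; unpack  = λ t≈t′ → idₚ , (λ _ → refl) , t≈t′
    ; pack    = λ {t} {t′} p via u v → trans (via u v) (cong₂ (Graph.adj (Tree.graph t′)) (p u) (p v))
    }
  unlabelled : ∀ n → Realisation (Setoid._≈_ (unlabeledTrees n))
  unlabelled n = record
    { Allowed = λ _ → ⊤
    ; comp    = λ _ _ → _
    ; inv     = λ _ → _
    ; unpack  = λ (π , via) → π , _ , via
    ; pack    = λ {_} {_} {π} _ via → π , via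
    }
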